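{- If a Berge graph $G$ admits a loose skew partition, then $G$ admits a balanced skew partition.
   Context: Graphs are finite and simple; Berge means every hole (induced cycle of length $\ge4$) and every antihole (induced subgraph whose complement is a hole) has even length. A path/antipath means an induced subgraph that is a path / whose complement is a path; length counts edges (of the complement for antipaths). $X$ is connected if $G|X$ is connected, anticonnected if $\overline G|X$ is connected; a component of a nonempty set $A$ is a maximal connected subset of $A$, an anticomponent a maximal anticonnected subset. A skew partition is a partition $(A,B)$ of $V(G)$ with $A$ not connected and $B$ not anticonnected. It is loose if either some vertex of $B$ has no neighbour in some component of $A$, or some vertex of $A$ is adjacent to every vertex of some anticomponent of $B$. It is balanced if there is no odd path between nonadjacent vertices of $B$ with interior in $A$ and no odd antipath between adjacent vertices of $A$ with interior in $B$. -}

module Defs where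

open import Level using (0ℓ) renaming (suc to lsuc)
open import Data.Nat.Base using (ℕ; suc; _≤_)
open import Data.Nat.Divisibility using (_∣_; _∤_)
open import Data.Fin.Base using (Fin; zero; toℕ; fromℕ)
import Data.Fin.Properties as Fin
open import Data.Fin.Subset using (Subset; _∈_; _⊆_; _∪_; _∩_; Nonempty; ⊤; ⊥)
open import Data.Product.Base using (_×_; _,_; ∃-syntax)
open import Data.Sum.Base using (_⊎_)
open import Function.Base using (_∘_)
open import Function.Bundles using (_⇔_)
open import Function.Definitions using (Injective)
open import Relation.Binary.Core using (Rel)
open import Relation.Binary.Definitions using (Decidable; Irreflexive; Symmetric)
open import Relation.Binary.Construct.Closure.ReflexiveTransitive using (Star)
open import Relation.Binary.Construct.Closure.Symmetric using (SymClosure)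
open import Relation.Binary.PropositionalEquality using (_≡_; _≢_; sym)
open import Relation.Nullary using (¬_)
open import Relation.Nullary.Decidable using (¬?; _×-dec_)

record Graph (n : ℕ) : Set (lsuc 0ℓ) where
  infix 4 _~_ _~?_
  field
    _~_      : Rel (Fin n) 0ℓ
    _~?_     : Decidable _~_
    ~-sym    : Symmetric _~_
    ~-irrefl : Irreflexive _≡_ _~_

complement : ∀ {n} → Graph n → Graph n
complement G = record
  { _~_      = λ u v → u ≢ v × ¬ (u ~ v)
  ; _~?_     = λ u v → ¬? (u Fin.≟ v) ×-dec ¬? (u ~? v)
  ; ~-sym    = λ (u≢v , u≁v) → u≢v ∘ sym , u≁v ∘ ~-sym
  ; ~-irrefl = λ u≡v (u≢v , _) → u≢v u≡v
  }
  where open Graph G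

Even Odd : ℕ → Set
Even k = 2 ∣ k
Odd  k = 2 ∤ k

-- Adjacency in the path, respectively cycle, on 0, 1, …, m - 1.
PathAdjacent : ∀ {m} → Rel (Fin m) 0ℓ
PathAdjacent = SymClosure λ i j → suc (toℕ i) ≡ toℕ j

CycleAdjacent : ∀ {m} → Rel (Fin m) 0ℓ
CycleAdjacent {m} =
  SymClosure λ i j → suc (toℕ i) ≡ toℕ j ⊎ (suc (toℕ i) ≡ m × toℕ j ≡ 0)

-- An induced subgraph that is a path or cycle is given by an enumeration of
-- its vertices in order.  Injectivity is needed: v₀ v₁ v₂ with v₂ = v₀ and
-- v₀ adjacent to v₁ satisfies the adjacency condition of a path.

record Hole {n} (G : Graph n) (m : ℕ) : Set where
  open Graph G
  field
    4≤length  : 4 ≤ m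
    vertex    : Fin m → Fin n
    injective : Injective _≡_ _≡_ vertex
    adjacent  : ∀ i j → vertex i ~ vertex j ⇔ CycleAdjacent i j

Antihole : ∀ {n} → Graph n → ℕ → Set
Antihole G = Hole (complement G)

record Berge {n} (G : Graph n) : Set where
  field
    holes-even     : ∀ {m} → Hole G m → Even m
    antiholes-even : ∀ {m} → Antihole G m → Even m

-- A path with k edges, hence k + 1 vertices, and ends u and v.
record Path {n} (G : Graph n) (k : ℕ) (u v : Fin n) : Set where
  open Graph G
  field
    vertex    : Fin (suc k) → Fin n
    injective : Injective _≡_ _≡_ vertex
    adjacent  : ∀ i j → vertex i ~ vertex j ⇔ PathAdjacent i j
    start     : vertex zero ≡ u
    end       : vertex (fromℕ k) ≡ v

  InteriorIn : Subset n → Set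
  InteriorIn X = ∀ i → i ≢ zero → i ≢ fromℕ k → vertex i ∈ X

Antipath : ∀ {n} → Graph n → ℕ → Fin n → Fin n → Set
Antipath G = Path (complement G)

module _ {n} (G : Graph n) where
  open Graph G

  -- Any two vertices of X are joined by a walk inside X; in particular the
  -- empty set is connected.
  Connected : Subset n → Set
  Connected X = ∀ {u v} → u ∈ X → v ∈ X →
    Star (λ x y → x ∈ X × y ∈ X × x ~ y) u v

  record IsComponent (A C : Subset n) : Set where
    field
      nonempty  : Nonempty A
      subset    : C ⊆ A
      connected : Connected C
      maximal   : ∀ {D} → D ⊆ A → Connected D → C ⊆ D → D ⊆ C

Anticonnected : ∀ {n} → Graph n → Subset n → Set
Anticonnected G = Connected (complement G)

IsAnticomponent : ∀ {n} → Graph n → Subset n → Subset n → Set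
IsAnticomponent G = IsComponent (complement G)

module _ {n} (G : Graph n) where
  open Graph G

  record IsSkewPartition (A B : Subset n) : Set where
    field
      cover             : A ∪ B ≡ ⊤
      disjoint          : A ∩ B ≡ ⊥
      not-connected     : ¬ Connected G A
      not-anticonnected : ¬ Anticonnected G B

  Loose : (A B : Subset n) → Set
  Loose A B =
      (∃[ v ] v ∈ B × ∃[ C ] IsComponent G A C × (∀ {u} → u ∈ C → ¬ (v ~ u)))
    ⊎ (∃[ v ] v ∈ A × ∃[ C ] IsAnticomponent G B C × (∀ {u} → u ∈ C → v ~ u))

  record Balanced (A B : Subset n) : Set where
    field
      no-odd-path : ∀ {k u v} → u ∈ B → v ∈ B → ¬ (u ~ v) →
        (P : Path G k u v) → Path.InteriorIn P A → ¬ Odd k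
      no-odd-antipath : ∀ {k u v} → u ∈ A → v ∈ A → u ~ v →
        (P : Antipath G k u v) → Path.InteriorIn P B → ¬ Odd k

  AdmitsLooseSkewPartition : Set
  AdmitsLooseSkewPartition = ∃[ A ] ∃[ B ] IsSkewPartition A B × Loose A B

  AdmitsBalancedSkewPartition : Set
  AdmitsBalancedSkewPartition = ∃[ A ] ∃[ B ] IsSkewPartition A B × Balanced A B

{-# OPTIONS --safe #-}

-- Complementing if necessary, some a ∈ A is complete to an anticomponent B₁ of B.
-- Let A₂ be a component of A that does not contain a.  A vertex of B₁ without
-- neighbours in A₂ can be moved to A, so we may assume that B₁ is a single vertex
-- or that all its vertices have neighbours in A₂.  The vertex a closes the paths
-- and antipaths between A₂ and B₁, which are therefore even; the Roussel–Rubio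
-- lemma in the complement extends this from A₂ to A.  Now move the B₁-complete
-- vertices of A to B, leaving one on either side of A where this would empty it.
-- Then B is B₁ together with B₁-complete vertices, while in A all vertices with a
-- neighbour on their side miss some vertex of B₁.  By the Roussel–Rubio lemma the
-- paths through A between B₁-complete vertices are even, and an antipath between
-- adjacent vertices of A through B₁-complete vertices forms an antihole with an
-- even antipath through B₁.
--
-- The Roussel–Rubio lemma is needed only for a set X that is balanced against the
-- interior of the path, which excludes leaps.  It is proved by induction on X.  If X
-- is not stable, it has adjacent x and y such that X ∖ x and X ∖ y are anticonnected and
-- either X ∖ {x , y} is anticonnected as well or x and y have a common nonneighbour
-- in X; counting edges complete to these subsets gives a contradiction.  If X is
-- stable, the contradiction is an inclusion–exclusion over the subsets of X.

module Submission where

open import Defs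
open import Level using (0ℓ)
open import Data.Bool.Base using (Bool; true; false; not; _∧_; _xor_)
open import Data.Bool.Properties
  using (not-injective; not-involutive; xor-same; xor-identityʳ; ∧-identityʳ)
open import Data.Nat.Base using (ℕ; zero; suc; _+_; _*_; _∸_; _≤_; _<_; z≤n; s≤s)
open import Data.Nat.Properties
open import Data.Nat.Divisibility using (divides)
open import Data.Fin.Base using (Fin; zero; suc; toℕ; fromℕ)
import Data.Fin.Properties as Fin
open import Data.Fin.Subset as Subset using (Subset; Nonempty; _∪_; ⁅_⁆; ∁)
open import Data.Fin.Subset.Properties
  using (nonempty?; x∈⁅x⁆; x∈⁅y⁆⇒x≡y; p⊆p∪q; q⊆p∪q; x∈p∪q⁻; x∈p∩q⁺; ∈⊤; ∉⊥; p∪∁p≡⊤; ∩-inverseʳ;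
         x∈∁p⇒x∉p; x∉p⇒x∈∁p)
  renaming (_∈?_ to _∈ˢ?_)
open import Data.Vec.Base using (tabulate)
open import Data.Vec.Properties using (lookup∘tabulate; lookup⇒[]=; []=⇒lookup)
open import Data.Product.Base using (_×_; _,_; proj₁; proj₂; ∃-syntax)
open import Data.Sum.Base using (_⊎_; inj₁; inj₂; [_,_]′)
open import Data.Empty using (⊥; ⊥-elim)
open import Data.List.Base using (List; []; _∷_; length; null; _++_; filter; allFin)
open import Data.List.Properties using (filter-notAll)
open import Data.List.Membership.Propositional using (_∈_; _∉_)
open import Data.List.Membership.Propositional.Properties
  using (∈-filter⁺; ∈-filter⁻; ∈-++⁺ˡ; ∈-++⁺ʳ; ∈-++⁻; ∈-allFin)
open import Data.List.Relation.Unary.Any using (here; there)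
import Data.List.Relation.Unary.Any as Any
open import Data.List.Relation.Unary.All using (All; []; _∷_)
import Data.List.Relation.Unary.All as All
open import Data.List.Relation.Unary.AllPairs using (AllPairs; []; _∷_)
open import Data.List.Relation.Binary.Permutation.Propositional
  using (_↭_; refl; prep; swap; trans; ↭-sym)
open import Data.List.Relation.Binary.Permutation.Propositional.Properties
  using (∈-resp-↭; ↭-length; drop-∷; All-resp-↭)
open import Function.Base using (_∘_; id; flip)
open import Function.Bundles using (mk⇔; Equivalence)
open import Relation.Binary.Core using (Rel)
open import Relation.Binary.Definitions using (tri<; tri≈; tri>)
open import Relation.Binary.Construct.Closure.ReflexiveTransitive using (Star; ε; _◅_; _◅◅_)
import Relation.Binary.Construct.Closure.ReflexiveTransitive as Star
open import Relation.Binary.Construct.Closure.Symmetric using (fwd; bwd; symmetric)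
open import Relation.Binary.PropositionalEquality
  using (_≡_; _≢_; refl; sym; cong; cong₂; subst; subst₂; ≢-sym) renaming (trans to ≡-trans)
open import Relation.Nullary using (¬_; Dec; yes; no; does)
open import Relation.Nullary.Decidable using (¬?; _×-dec_; _⊎-dec_)
open import Relation.Nullary.Negation using (contradiction)

-- Parity and counting modulo 2

parity : ℕ → Bool
parity zero    = false
parity (suc k) = not (parity k)

xorSum : (ℕ → Bool) → ℕ → Bool
xorSum f zero    = false
xorSum f (suc k) = f k xor xorSum f k

-- The parity of the number of k with lo ≤ k < hi and f k, provided lo ≤ hi.
count : (ℕ → Bool) → ℕ → ℕ → Bool
count f lo hi = xorSum f lo xor xorSum f hi

xor-≡⇒≡ : ∀ {a b} → a xor b ≡ false → a ≡ b
xor-≡⇒≡ {false} {false} _ = refl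
xor-≡⇒≡ {true}  {true}  _ = refl

xorSum-true : ∀ k → xorSum (λ _ → true) k ≡ parity k
xorSum-true zero    = refl
xorSum-true (suc k) = cong not (xorSum-true k)

count-step : ∀ f lo hi → count f lo (suc hi) ≡ f hi xor count f lo hi
count-step f lo hi = lemma (xorSum f lo) (f hi) (xorSum f hi)
  where
  lemma : ∀ a b c → a xor (b xor c) ≡ b xor (a xor c)
  lemma false b     c     = refl
  lemma true  false c     = refl
  lemma true  true  false = refl
  lemma true  true  true  = refl

range-induction : ∀ {lo hi} (P : ℕ → Set) → lo ≤ hi → P lo →
  (∀ k → lo ≤ k → k < hi → P k → P (suc k)) → P hi
range-induction {lo} {hi} P lo≤hi base step with m≤n⇒m<n∨m≡n lo≤hi
... | inj₂ refl = base
range-induction {lo} {suc hi} P _ base step | inj₁ (s≤s lo≤hi) =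
  step hi lo≤hi ≤-refl (range-induction P lo≤hi base λ k l u → step k l (m≤n⇒m≤1+n u))

count-cong : ∀ {f g lo hi} → lo ≤ hi → (∀ k → lo ≤ k → k < hi → f k ≡ g k) →
  count f lo hi ≡ count g lo hi
count-cong {f} {g} {lo} lo≤hi eq =
  range-induction (λ hi → count f lo hi ≡ count g lo hi) lo≤hi
    (≡-trans (xor-same (xorSum f lo)) (sym (xor-same (xorSum g lo))))
    λ k l u ih → ≡-trans (count-step f lo k)
      (≡-trans (cong₂ _xor_ (eq k l u) ih) (sym (count-step g lo k)))

xor-interchange : ∀ a b c d → (a xor b) xor (c xor d) ≡ (a xor c) xor (b xor d)
xor-interchange false false c     d     = refl
xor-interchange false true  false d     = refl
xor-interchange false true  true  false = refl
xor-interchange false true  true  true  = refl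
xor-interchange true  false false d     = refl
xor-interchange true  false true  false = refl
xor-interchange true  false true  true  = refl
xor-interchange true  true  false false = refl
xor-interchange true  true  false true  = refl
xor-interchange true  true  true  false = refl
xor-interchange true  true  true  true  = refl

xorSum-xor : ∀ f g k → xorSum (λ k → f k xor g k) k ≡ xorSum f k xor xorSum g k
xorSum-xor f g zero = refl
xorSum-xor f g (suc k) rewrite xorSum-xor f g k = xor-interchange (f k) (g k) (xorSum f k) (xorSum g k)

count-xor : ∀ f g lo hi → count (λ k → f k xor g k) lo hi ≡ count f lo hi xor count g lo hi
count-xor f g lo hi rewrite xorSum-xor f g lo | xorSum-xor f g hi =
  xor-interchange (xorSum f lo) (xorSum g lo) (xorSum f hi) (xorSum g hi)

count-false : ∀ {f lo hi} → lo ≤ hi → (∀ k → lo ≤ k → k < hi → f k ≡ false) → count f lo hi ≡ false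
count-false {f} {lo} lo≤hi eq = range-induction (λ hi → count f lo hi ≡ false) lo≤hi
  (xor-same (xorSum f lo))
  λ k l u ih → ≡-trans (count-step f lo k) (cong₂ _xor_ (eq k l u) ih)

count-true : ∀ lo hi → count (λ _ → true) lo hi ≡ parity lo xor parity hi
count-true lo hi = cong₂ _xor_ (xorSum-true lo) (xorSum-true hi)

count≡true⇒∃ : ∀ {f lo hi} → lo ≤ hi → count f lo hi ≡ true → ∃[ k ] lo ≤ k × k < hi × f k ≡ true
count≡true⇒∃ {f} {lo} {hi} lo≤hi eq with m≤n⇒m<n∨m≡n lo≤hi
... | inj₂ refl with () ← ≡-trans (sym eq) (xor-same (xorSum f lo))
count≡true⇒∃ {f} {lo} {suc hi} _ eq | inj₁ (s≤s lo≤hi) with f hi in fhi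
... | true  = hi , lo≤hi , ≤-refl , fhi
... | false with k , l , u , e ← count≡true⇒∃ {f} lo≤hi eq = k , l , m≤n⇒m≤1+n u , e

-- Equality of `g` telescopes over the consecutive positions at which `U` holds. In `scan`, `i` is
-- the last such position found, `m` the next candidate and `d` the distance from `m` to `hi`.
gaps : ∀ {U : ℕ → Set} → (∀ k → Dec (U k)) → (g : ℕ → Bool) → ∀ {lo hi} → lo < hi → U lo → U hi →
  (∀ i j → lo ≤ i → i < j → j ≤ hi → U i → U j → (∀ k → i < k → k < j → ¬ U k) → g i ≡ g j) →
  g lo ≡ g hi
gaps {U} U? g {lo} {hi} lo<hi Ulo Uhi gap =
  scan (hi ∸ suc lo) lo (suc lo) (m∸n+n≡m lo<hi) ≤-refl ≤-refl Ulo refl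
    λ k l u → contradiction l (<⇒≱ u)
  where
  scan : ∀ d i m → d + m ≡ hi → lo ≤ i → i < m → U i → g lo ≡ g i →
    (∀ k → i < k → k < m → ¬ U k) → g lo ≡ g hi
  scan zero i m refl lo≤i i<m Ui eq none =
    ≡-trans eq (gap i m lo≤i i<m ≤-refl Ui Uhi none)
  scan (suc d) i m dm lo≤i i<m Ui eq none with U? m
  ... | yes Um = scan d m (suc m) (≡-trans (+-suc d m) dm) (≤-trans lo≤i (<⇒≤ i<m)) ≤-refl Um
          (≡-trans eq (gap i m lo≤i i<m (subst (m ≤_) dm (m≤n+m m (suc d))) Ui Um none))
          λ k l u → contradiction l (<⇒≱ u)
  ... | no ¬Um = scan d i (suc m) (≡-trans (+-suc d m) dm) lo≤i (m≤n⇒m≤1+n i<m) Ui eq none′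
    where
    none′ : ∀ k → i < k → k < suc m → ¬ U k
    none′ k l (s≤s u) with m≤n⇒m<n∨m≡n u
    ... | inj₁ k<m  = none k l k<m
    ... | inj₂ refl = ¬Um

least : ∀ {P : ℕ → Set} → (∀ k → Dec (P k)) → ∀ m → P m →
  ∃[ k ] k ≤ m × P k × (∀ j → j < k → ¬ P j)
least P? zero    Pm = 0 , z≤n , Pm , λ _ ()
least P? (suc m) Pm with P? 0
... | yes P0 = 0 , z≤n , P0 , λ _ ()
... | no ¬P0 with k , k≤m , Pk , below ← least (P? ∘ suc) m Pm =
  suc k , s≤s k≤m , Pk , λ { zero _ → ¬P0 ; (suc j) (s≤s j<k) → below j j<k }

-- Induced paths as sequences; Berge graphs as a pair of relations

update : ∀ {V : Set} → (ℕ → V) → ℕ → V → ℕ → V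
update p i x k with k ≟ i
... | yes _ = x
... | no  _ = p k

update-≡ : ∀ {V : Set} (p : ℕ → V) i x → update p i x i ≡ x
update-≡ p i x with i ≟ i
... | yes _   = refl
... | no  i≢i = contradiction refl i≢i

update-≢ : ∀ {V : Set} (p : ℕ → V) {i} x {k} → k ≢ i → update p i x k ≡ p k
update-≢ p {i} x {k} k≢i with k ≟ i
... | yes k≡i = contradiction k≡i k≢i
... | no  _   = refl

-- The vertices p lo, …, p hi form an induced path for the adjacency R with nonadjacency S.
record InducedPath {V : Set} (R S : Rel V 0ℓ) (p : ℕ → V) (lo hi : ℕ) : Set where
  constructor inducedPath
  field
    lo≤hi : lo ≤ hi
    edge  : ∀ {k} → lo ≤ k → k < hi → R (p k) (p (suc k))
    chord : ∀ {k l} → lo ≤ k → suc k < l → l ≤ hi → S (p k) (p l)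

open InducedPath

module _ {V : Set} {R S : Rel V 0ℓ} {p : ℕ → V} {lo hi : ℕ} where

  subpath : InducedPath R S p lo hi → ∀ {i j} → lo ≤ i → i ≤ j → j ≤ hi → InducedPath R S p i j
  subpath P lo≤i i≤j j≤hi = inducedPath i≤j
    (λ l u → edge P (≤-trans lo≤i l) (≤-trans u j≤hi))
    (λ l m u → chord P (≤-trans lo≤i l) m (≤-trans u j≤hi))

  extendʳ : InducedPath R S p lo hi → ∀ {x} → R (p hi) x →
    (∀ {k} → lo ≤ k → k < hi → S (p k) x) → InducedPath R S (update p (suc hi) x) lo (suc hi)
  extendʳ P {x} Rx Sx = inducedPath (m≤n⇒m≤1+n (lo≤hi P)) edge′ chord′
    where
    old : ∀ {k} → k ≤ hi → update p (suc hi) x k ≡ p k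
    old k≤hi = update-≢ p x (<⇒≢ (s≤s k≤hi))
    edge′ : ∀ {k} → lo ≤ k → k < suc hi → R (update p (suc hi) x k) (update p (suc hi) x (suc k))
    edge′ {k} l (s≤s u) with m≤n⇒m<n∨m≡n u
    ... | inj₁ k<hi = subst₂ R (sym (old u)) (sym (old k<hi)) (edge P l k<hi)
    ... | inj₂ refl = subst₂ R (sym (old ≤-refl)) (sym (update-≡ p (suc hi) x)) Rx
    chord′ : ∀ {k m} → lo ≤ k → suc k < m → m ≤ suc hi →
      S (update p (suc hi) x k) (update p (suc hi) x m)
    chord′ {k} {m} l k<m u with m≤n⇒m<n∨m≡n u
    ... | inj₁ (s≤s m≤hi) = subst₂ S
            (sym (old (≤-trans (n≤1+n k) (≤-trans (<⇒≤ k<m) m≤hi)))) (sym (old m≤hi)) (chord P l k<m m≤hi)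
    ... | inj₂ refl = subst₂ S
            (sym (old (<⇒≤ (≤-pred k<m)))) (sym (update-≡ p (suc hi) x)) (Sx l (≤-pred k<m))

-- The lower bound has the form `suc i` so that there is an index left for `x`.
extendˡ : ∀ {V : Set} {R S : Rel V 0ℓ} {p : ℕ → V} {i hi} → InducedPath R S p (suc i) hi →
  ∀ {x} → R x (p (suc i)) → (∀ {k} → suc i < k → k ≤ hi → S x (p k)) →
  InducedPath R S (update p i x) i hi
extendˡ {R = R} {S} {p} {i} {hi} P {x} Rx Sx = inducedPath (<⇒≤ (lo≤hi P)) edge′ chord′
  where
  old : ∀ {k} → i < k → update p i x k ≡ p k
  old i<k = update-≢ p x (≢-sym (<⇒≢ i<k))
  edge′ : ∀ {k} → i ≤ k → k < hi → R (update p i x k) (update p i x (suc k))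
  edge′ {k} l u with m≤n⇒m<n∨m≡n l
  ... | inj₁ i<k  = subst₂ R (sym (old i<k)) (sym (old (m≤n⇒m≤1+n i<k))) (edge P i<k u)
  ... | inj₂ refl = subst₂ R (sym (update-≡ p i x)) (sym (old ≤-refl)) Rx
  chord′ : ∀ {k m} → i ≤ k → suc k < m → m ≤ hi → S (update p i x k) (update p i x m)
  chord′ {k} {m} l k<m u with m≤n⇒m<n∨m≡n l
  ... | inj₁ i<k  = subst₂ S (sym (old i<k)) (sym (old (<-trans i<k (<-trans (n<1+n k) k<m))))
          (chord P i<k k<m u)
  ... | inj₂ refl = subst₂ S (sym (update-≡ p i x)) (sym (old (<-trans (n<1+n i) k<m))) (Sx k<m u)

Interior : ∀ {V : Set} → (V → Set) → (ℕ → V) → ℕ → ℕ → Set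
Interior T p lo hi = ∀ {k} → lo < k → k < hi → T (p k)

-- A hole is given as an induced path together with one further vertex.
HolesEven : ∀ {V : Set} → Rel V 0ℓ → Rel V 0ℓ → Set
HolesEven R S = ∀ {p lo hi x} → InducedPath R S p lo hi → suc lo < hi →
  R x (p lo) → R x (p hi) → Interior (S x) p lo hi → parity lo ≡ parity hi

-- Nonadjacency is a relation of its own, so that complementation merely swaps the two.
record BergeRelation (V : Set) : Set₁ where
  infix 4 _~_ _≁_
  field
    _~_ _≁_        : Rel V 0ℓ
    trichotomy     : ∀ u v → u ≡ v ⊎ u ~ v ⊎ u ≁ v
    ~-irrefl       : ∀ {v} → ¬ (v ~ v)
    ≁-irrefl       : ∀ {v} → ¬ (v ≁ v)
    exclusive      : ∀ {u v} → u ~ v → u ≁ v → ⊥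
    ~-sym          : ∀ {u v} → u ~ v → v ~ u
    ≁-sym          : ∀ {u v} → u ≁ v → v ≁ u
    holes-even     : HolesEven _~_ _≁_
    antiholes-even : HolesEven _≁_ _~_

dual : ∀ {V} → BergeRelation V → BergeRelation V
dual 𝔾 = record
  { _~_ = _≁_ ; _≁_ = _~_
  ; trichotomy = λ u v → [ inj₁ , [ inj₂ ∘ inj₂ , inj₂ ∘ inj₁ ]′ ]′ (trichotomy u v)
  ; ~-irrefl = ≁-irrefl ; ≁-irrefl = ~-irrefl ; exclusive = flip exclusive
  ; ~-sym = ≁-sym ; ≁-sym = ~-sym ; holes-even = antiholes-even ; antiholes-even = holes-even
  }
  where open BergeRelation 𝔾

-- An order in which a nonempty connected set can be built up, each vertex being new and related to
-- one already present. Inductions on connected sets follow this order, and the lack of repetitions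
-- makes the length the number of vertices.
data ConnectedList {V : Set} (R : Rel V 0ℓ) : List V → Set where
  single : ∀ x → ConnectedList R (x ∷ [])
  attach : ∀ {x w l} → x ∉ l → w ∈ l → R x w → ConnectedList R l → ConnectedList R (x ∷ l)

Step : ∀ {V : Set} → Rel V 0ℓ → (V → Set) → Rel V 0ℓ
Step R T x y = T x × T y × R x y

search : ∀ {A : Set} {P Q : A → Set} (l : List A) → (∀ {x} → x ∈ l → P x ⊎ Q x) →
  (∀ {x} → x ∈ l → P x) ⊎ (∃[ x ] x ∈ l × Q x)
search [] f = inj₁ λ ()
search (x ∷ l) f with f (here refl) | search l (f ∘ there)
... | inj₂ q | _ = inj₂ (x , here refl , q)
... | inj₁ p | inj₂ (y , y∈l , q) = inj₂ (y , there y∈l , q)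
... | inj₁ p | inj₁ ps = inj₁ λ { (here refl) → p ; (there z∈l) → ps z∈l }

parity-+ : ∀ a b → parity (a + b) ≡ parity a xor parity b
parity-+ zero    b = refl
parity-+ (suc a) b = ≡-trans (cong not (parity-+ a b)) (lemma (parity a) (parity b))
  where
  lemma : ∀ a b → not (a xor b) ≡ not a xor b
  lemma false b     = refl
  lemma true  false = refl
  lemma true  true  = refl

-- Paths in a Berge graph

module Paths {V : Set} (𝔾 : BergeRelation V) where
  open BergeRelation 𝔾

  IsPath : (ℕ → V) → ℕ → ℕ → Set
  IsPath = InducedPath _~_ _≁_

  ~⇒≢ : ∀ {u v} → u ~ v → u ≢ v
  ~⇒≢ u~v refl = ~-irrefl u~v

  ≁⇒≢ : ∀ {u v} → u ≁ v → u ≢ v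
  ≁⇒≢ u≁v refl = ≁-irrefl u≁v

  ≢⇒~⊎≁ : ∀ {u v} → u ≢ v → u ~ v ⊎ u ≁ v
  ≢⇒~⊎≁ {u} {v} u≢v with trichotomy u v
  ... | inj₁ u≡v = contradiction u≡v u≢v
  ... | inj₂ r   = r

  ¬~⇒≁ : ∀ {u v} → u ≢ v → ¬ (u ~ v) → u ≁ v
  ¬~⇒≁ u≢v ¬u~v = [ (λ u~v → contradiction u~v ¬u~v) , id ]′ (≢⇒~⊎≁ u≢v)

  _~?_ : ∀ u v → Dec (u ~ v)
  u ~? v with trichotomy u v
  ... | inj₁ refl        = no ~-irrefl
  ... | inj₂ (inj₁ u~v) = yes u~v
  ... | inj₂ (inj₂ u≁v) = no λ u~v → exclusive u~v u≁v

  _≡?_ : (u v : V) → Dec (u ≡ v)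
  u ≡? v with trichotomy u v
  ... | inj₁ u≡v        = yes u≡v
  ... | inj₂ (inj₁ u~v) = no (~⇒≢ u~v)
  ... | inj₂ (inj₂ u≁v) = no (≁⇒≢ u≁v)

  _∈?_ : ∀ x l → Dec (x ∈ l)
  x ∈? [] = no λ ()
  x ∈? (y ∷ l) with x ≡? y | x ∈? l
  ... | yes x≡y | _       = yes (here x≡y)
  ... | no _    | yes x∈l = yes (there x∈l)
  ... | no x≢y  | no x∉l  = no λ { (here x≡y) → x≢y x≡y ; (there x∈l) → x∉l x∈l }

  Complete : List V → V → Set
  Complete X v = ∀ {x} → x ∈ X → x ~ v

  complete? : ∀ X v → Dec (Complete X v)
  complete? X v with search X (λ {x} _ → dec x)
    where
    dec : ∀ x → x ~ v ⊎ ¬ (x ~ v)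
    dec x with x ~? v
    ... | yes r = inj₁ r
    ... | no ¬r = inj₂ ¬r
  ... | inj₁ all = yes all
  ... | inj₂ (x , x∈X , ¬r) = no λ c → ¬r (c x∈X)

  module _ {p lo hi} (P : IsPath p lo hi) where

    path-injective : ∀ {k l} → lo ≤ k → k < l → l ≤ hi → p k ≢ p l
    path-injective lo≤k k<l l≤hi with m≤n⇒m<n∨m≡n k<l
    ... | inj₁ 1+k<l = ≁⇒≢ (chord P lo≤k 1+k<l l≤hi)
    ... | inj₂ refl  = ~⇒≢ (edge P lo≤k l≤hi)

    nonadjacent-ends : p lo ≁ p hi → suc lo < hi
    nonadjacent-ends ends with m≤n⇒m<n∨m≡n (lo≤hi P)
    ... | inj₂ refl = contradiction ends ≁-irrefl
    ... | inj₁ lo<hi with m≤n⇒m<n∨m≡n lo<hi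
    ...   | inj₁ 1+lo<hi = 1+lo<hi
    ...   | inj₂ refl    = ⊥-elim (exclusive (edge P ≤-refl ≤-refl) ends)

    -- By injectivity there is only one interior vertex, so the path has two edges.
    constant-interior : p lo ≁ p hi → ∀ {c} → Interior (_≡ c) p lo hi → parity lo ≡ parity hi
    constant-interior ends const with nonadjacent-ends ends
    ... | 1+lo<hi with m≤n⇒m<n∨m≡n 1+lo<hi
    ...   | inj₂ refl = lemma (parity lo)
      where
      lemma : ∀ a → a ≡ not (not a)
      lemma false = refl
      lemma true  = refl
    ...   | inj₁ 2+lo<hi = contradiction
              (≡-trans (const ≤-refl 1+lo<hi) (sym (const (m≤n⇒m≤1+n ≤-refl) 2+lo<hi)))
              (path-injective (n≤1+n lo) ≤-refl 1+lo<hi)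

  -- Cutting the path at its first vertex that equals `x` or is adjacent to it keeps the result
  -- induced.
  extendToNeighbour : ∀ {p m x} {T : V → Set} → IsPath p 0 m → x ≢ p 0 → x ~ p m →
    (∀ {k} → 0 < k → k ≤ m → T (p k)) →
    ∃[ q ] ∃[ m′ ] IsPath q 0 m′ × q 0 ≡ p 0 × q m′ ≡ x × Interior T q 0 m′
  extendToNeighbour {p} {m} {x} {T} P x≢p0 x~pm Tp
    with least {P = λ k → x ≡ p k ⊎ x ~ p k} touches m (inj₂ x~pm)
    where
    touches : ∀ k → Dec (x ≡ p k ⊎ x ~ p k)
    touches k with trichotomy x (p k)
    ... | inj₁ eq       = yes (inj₁ eq)
    ... | inj₂ (inj₁ r) = yes (inj₂ r)
    ... | inj₂ (inj₂ s) = no [ ≁⇒≢ s , flip exclusive s ]′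
  ... | k , k≤m , inj₁ x≡pk , _ =
    p , k , subpath P ≤-refl z≤n k≤m , refl , sym x≡pk , λ l u → Tp l (≤-trans (<⇒≤ u) k≤m)
  ... | k , k≤m , inj₂ x~pk , below =
    update p (suc k) x , suc k ,
    extendʳ (subpath P ≤-refl z≤n k≤m) (~-sym x~pk)
      (λ {j} _ j<k → ≁-sym (¬~⇒≁ (λ e → below j j<k (inj₁ e)) (λ r → below j j<k (inj₂ r)))) ,
    refl , update-≡ p (suc k) x ,
    λ { l (s≤s u) → subst T (sym (update-≢ p x (<⇒≢ (s≤s u)))) (Tp l (≤-trans u k≤m)) }

  -- The walk is followed step by step, and `extendToNeighbour` shortcuts the path at each step. As
  -- `v` lies outside `T`, the walk never returns to the start of the path.
  pathAlongWalk : ∀ {T p m v x} → ¬ T v → IsPath p 0 m → p 0 ≡ v →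
    (∀ {k} → 0 < k → k ≤ m → T (p k)) → Star (Step _~_ T) (p m) x →
    ∃[ q ] ∃[ m′ ] IsPath q 0 m′ × q 0 ≡ v × q m′ ≡ x × (∀ {k} → 0 < k → k ≤ m′ → T (q k))
  pathAlongWalk {p = p} {m} ¬Tv P p0 Tp ε = p , m , P , p0 , refl , Tp
  pathAlongWalk {T} ¬Tv P refl Tp (_◅_ {j = y} (_ , Ty , r) w)
    with q , m , Q , q0 , refl , Tq ← extendToNeighbour {T = T} P (λ { refl → ¬Tv Ty }) (~-sym r) Tp =
    pathAlongWalk {T} ¬Tv Q q0 T-upto w
    where
    T-upto : ∀ {k} → 0 < k → k ≤ m → T (q k)
    T-upto l u with m≤n⇒m<n∨m≡n u
    ... | inj₁ k<m  = Tq l k<m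
    ... | inj₂ refl = Ty

  pathThrough : ∀ {T u v w z} → (∀ {a b} → T a → T b → Star (Step _~_ T) a b) →
    ¬ T u → ¬ T v → u ≢ v → T w → v ~ w → T z → u ~ z →
    ∃[ q ] ∃[ m ] IsPath q 0 m × q 0 ≡ v × q m ≡ u × Interior T q 0 m
  pathThrough {T} {u} {v} {w} {z} walk ¬Tu ¬Tv u≢v Tw v~w Tz u~z
    with q , m , Q , q0 , refl , Tq ← pathAlongWalk {T} {update (λ _ → v) 1 w} {1} ¬Tv
      (extendʳ (inducedPath z≤n (λ _ ()) (λ { _ () z≤n })) v~w λ { _ () })
      refl (λ { {suc zero} _ _ → Tw ; {suc (suc k)} _ (s≤s ()) }) (walk Tw Tz)
    with q′ , m′ , Q′ , q′0 , q′m , Tq′ ← extendToNeighbour {T = T} Q (λ { refl → u≢v q0 }) u~z Tq =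
    q′ , m′ , Q′ , ≡-trans q′0 q0 , q′m , Tq′

  walkInList : ∀ {l} → ConnectedList _~_ l → ∀ {a b} → a ∈ l → b ∈ l → Star (Step _~_ (_∈ l)) a b
  walkInList (single x) (here refl) (here refl) = ε
  walkInList (attach {x} {w} {l} x∉l w∈l x~w c) = walk
    where
    weaken : ∀ {a b} → Star (Step _~_ (_∈ l)) a b → Star (Step _~_ (_∈ (x ∷ l))) a b
    weaken ε = ε
    weaken ((a∈l , b∈l , r) ◅ s) = (there a∈l , there b∈l , r) ◅ weaken s
    walk : ∀ {a b} → a ∈ (x ∷ l) → b ∈ (x ∷ l) → Star (Step _~_ (_∈ (x ∷ l))) a b
    walk (here refl) (here refl) = ε
    walk (here refl) (there b∈l) = (here refl , there w∈l , x~w) ◅ weaken (walkInList c w∈l b∈l)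
    walk (there a∈l) (here refl) =
      weaken (walkInList c a∈l w∈l) ◅◅ ((there w∈l , here refl , ~-sym x~w) ◅ ε)
    walk (there a∈l) (there b∈l) = weaken (walkInList c a∈l b∈l)

  neighbourInList : ∀ {l} → ConnectedList _~_ l → ∀ {a b} → a ∈ l → b ∈ l → a ≢ b →
    ∃[ w ] w ∈ l × a ~ w
  neighbourInList c a∈l b∈l a≢b with walkInList c a∈l b∈l
  ... | ε = contradiction refl a≢b
  ... | _◅_ {j = w} (_ , w∈l , a~w) _ = w , w∈l , a~w

  -- The two paths form a cycle, brought into the shape of `HolesEven`: `p lo` is the further
  -- vertex, and `r` runs from `p (suc lo)` to `p hi` and then along `q` up to the vertex before
  -- `p lo`.
  closed-pair-even : ∀ {p lo hi q m} → IsPath p lo hi → IsPath q 0 m → p hi ≡ q 0 → p lo ≡ q m →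
    p lo ≁ p hi → (∀ {k j} → lo < k → k < hi → 0 < j → j < m → p k ≁ q j) →
    parity m ≡ false → parity lo ≡ parity hi
  closed-pair-even {p} {lo} {hi} {q} {zero} P Q pq qp ends apart even =
    contradiction (subst₂ _≁_ qp pq ends) ≁-irrefl
  closed-pair-even {p} {lo} {hi} {q} {suc m} P Q pq qp ends apart even =
    not-injective (≡-trans
      (holes-even {r} {suc lo} {hi + m} {p lo}
        (inducedPath (≤-trans (<⇒≤ 1+lo<hi) (m≤m+n hi m)) r-edge r-chord)
        (subst (_≤ hi + m) (+-comm (suc (suc lo)) 1) (+-mono-≤ 1+lo<hi 0<m))
        (subst (p lo ~_) (sym (r-low (<⇒≤ 1+lo<hi))) (edge P ≤-refl (<⇒≤ 1+lo<hi)))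
        (subst₂ _~_ (sym qp) (sym (r-high m)) (~-sym (edge Q z≤n ≤-refl)))
        r-closing)
      (≡-trans (parity-+ hi m) (lemma (parity hi) (parity m) even)))
    where
    1+lo<hi = nonadjacent-ends P ends
    0<m = ≤-pred (nonadjacent-ends Q (≁-sym (subst₂ _≁_ qp pq ends)))
    lemma : ∀ a b → not b ≡ false → a xor b ≡ not a
    lemma false true _ = refl
    lemma true  true _ = refl
    r : ℕ → V
    r k with k ≤? hi
    ... | yes _ = p k
    ... | no  _ = q (k ∸ hi)
    r-low : ∀ {k} → k ≤ hi → r k ≡ p k
    r-low {k} k≤hi with k ≤? hi
    ... | yes _   = refl
    ... | no k≰hi = contradiction k≤hi k≰hi
    r-high : ∀ j → r (hi + j) ≡ q j
    r-high j with hi + j ≤? hi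
    ... | no _ = cong q (m+n∸m≡n hi j)
    r-high zero | yes _ = ≡-trans (cong p (+-identityʳ hi)) pq
    r-high (suc j) | yes le = contradiction le (m+1+n≰m hi)
    r-edge : ∀ {k} → suc lo ≤ k → k < hi + m → r k ~ r (suc k)
    r-edge {k} l u with <-≤-connex k hi
    ... | inj₁ k<hi = subst₂ _~_ (sym (r-low (<⇒≤ k<hi))) (sym (r-low k<hi)) (edge P (<⇒≤ l) k<hi)
    ... | inj₂ hi≤k with j , refl ← m≤n⇒∃[o]m+o≡n hi≤k =
      subst₂ _~_ (sym (r-high j)) (≡-trans (sym (r-high (suc j))) (cong r (+-suc hi j)))
        (edge Q z≤n (<-trans (+-cancelˡ-< hi j m u) ≤-refl))
    r-chord : ∀ {k l} → suc lo ≤ k → suc k < l → l ≤ hi + m → r k ≁ r l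
    r-chord {k} {l} lo<k k<l u with <-≤-connex k hi | <-≤-connex hi l
    ... | _ | inj₂ l≤hi = subst₂ _≁_ (sym (r-low (≤-trans (<⇒≤ (<⇒≤ k<l)) l≤hi))) (sym (r-low l≤hi))
            (chord P (<⇒≤ lo<k) k<l l≤hi)
    ... | inj₁ k<hi | inj₁ hi<l with j , refl ← m≤n⇒∃[o]m+o≡n (<⇒≤ hi<l) =
      subst₂ _≁_ (sym (r-low (<⇒≤ k<hi))) (sym (r-high j))
        (apart lo<k k<hi (positive hi<l) (s≤s (+-cancelˡ-≤ hi j m u)))
      where
      positive : ∀ {j} → hi < hi + j → 0 < j
      positive {zero}  lt = contradiction lt (<-irrefl (sym (+-identityʳ hi)))
      positive {suc _} _  = s≤s z≤n
    ... | inj₂ hi≤k | inj₁ hi<l with i , refl ← m≤n⇒∃[o]m+o≡n hi≤k | j , refl ← m≤n⇒∃[o]m+o≡n (<⇒≤ hi<l) =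
      subst₂ _≁_ (sym (r-high i)) (sym (r-high j))
        (chord Q z≤n (+-cancelˡ-< hi (suc i) j (subst (_< hi + j) (sym (+-suc hi i)) k<l))
          (m≤n⇒m≤1+n (+-cancelˡ-≤ hi j m u)))
    r-closing : Interior (p lo ≁_) r (suc lo) (hi + m)
    r-closing {k} l u with <-≤-connex hi k
    ... | inj₂ k≤hi = subst (p lo ≁_) (sym (r-low k≤hi)) (chord P ≤-refl l k≤hi)
    ... | inj₁ hi<k with j , refl ← m≤n⇒∃[o]m+o≡n (<⇒≤ hi<k) =
      subst₂ _≁_ (sym qp) (sym (r-high j))
        (≁-sym (chord Q z≤n (s≤s (+-cancelˡ-< hi j m u)) ≤-refl))

  -- Two paths with the same ends and mutually anticomplete interiors form a hole.
  parity-via : ∀ {p lo hi l} {T : V → Set} → IsPath p lo hi → p lo ≁ p hi → Interior T p lo hi →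
    (∀ {x y} → T x → y ∈ l → x ≁ y) → ConnectedList _~_ l → p lo ∉ l → p hi ∉ l →
    (∃[ w ] w ∈ l × p lo ~ w) → (∃[ w ] w ∈ l × p hi ~ w) →
    (∀ {q m} → IsPath q 0 m → q 0 ≡ p hi → q m ≡ p lo → Interior (_∈ l) q 0 m → parity m ≡ false) →
    parity lo ≡ parity hi
  parity-via P ends inT apart conn lo∉ hi∉ (w , w∈ , lo~w) (z , z∈ , hi~z) even
    with q , m , Q , q0 , qm , inl ← pathThrough (walkInList conn) lo∉ hi∉ (≁⇒≢ ends) z∈ hi~z w∈ lo~w =
    closed-pair-even P Q (sym q0) (sym qm) ends
      (λ l u l′ u′ → apart (inT l u) (inl l′ u′)) (even Q q0 qm inl)

  -- The side of the first interior vertex propagates along the path, since no edge joins `S` to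
  -- `T`.
  path-in-one-side : ∀ {S T : V → Set} → (∀ {x y} → S x → T y → x ≁ y) →
    ∀ {p lo hi} → IsPath p lo hi → suc lo < hi → Interior (λ v → S v ⊎ T v) p lo hi →
    Interior S p lo hi ⊎ Interior T p lo hi
  path-in-one-side {S} {T} apart {p} {lo} {hi} P 1+lo<hi inST with inST ≤-refl 1+lo<hi
  ... | inj₁ s = inj₁ λ l u → range-induction (λ k → k < hi → S (p k)) l (λ _ → s) (step u) u
    where
    step : ∀ {j} → j < hi → ∀ k → suc lo ≤ k → k < j → (k < hi → S (p k)) → suc k < hi → S (p (suc k))
    step _ k l _ ih u with inST (m≤n⇒m≤1+n l) u
    ... | inj₁ s = s
    ... | inj₂ t = ⊥-elim (exclusive (edge P (<⇒≤ l) (<⇒≤ u)) (apart (ih (<⇒≤ u)) t))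
  ... | inj₂ t = inj₂ λ l u → range-induction (λ k → k < hi → T (p k)) l (λ _ → t) (step u) u
    where
    step : ∀ {j} → j < hi → ∀ k → suc lo ≤ k → k < j → (k < hi → T (p k)) → suc k < hi → T (p (suc k))
    step _ k l _ ih u with inST (m≤n⇒m≤1+n l) u
    ... | inj₁ s = ⊥-elim (exclusive (~-sym (edge P (<⇒≤ l) (<⇒≤ u))) (apart s (ih (<⇒≤ u))))
    ... | inj₂ t = t

  -- Components

  without : V → List V → List V
  without x = filter (λ z → ¬? (z ≡? x))

  length-without : ∀ {x l} → x ∈ l → length (without x l) < length l
  length-without {x} {l} x∈l = filter-notAll (λ z → ¬? (z ≡? x)) l (Any.map (λ { refl ≢ → ≢ refl }) x∈l)

  ∈-without⁻ : ∀ {x z l} → z ∈ without x l → z ∈ l × z ≢ x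
  ∈-without⁻ {x} {z} {l} = ∈-filter⁻ (λ z → ¬? (z ≡? x)) {xs = l}

  ∈-without⁺ : ∀ {x z l} → z ∈ l → z ≢ x → z ∈ without x l
  ∈-without⁺ {x} = ∈-filter⁺ (λ z → ¬? (z ≡? x))

  -- `K` arises from `K₀` by absorbing vertices of `R₀` as long as possible, and `R` is what
  -- remains. The bound `size` lets the recursion of `balance` terminate.
  record Component (K₀ R₀ : List V) : Set where
    field
      {K R}     : List V
      connected : ConnectedList _~_ K
      apart     : ∀ {k r} → k ∈ K → r ∈ R → k ≁ r
      extends   : ∀ {z} → z ∈ K₀ → z ∈ K
      K⊆        : ∀ {z} → z ∈ K → z ∈ K₀ ⊎ z ∈ R₀
      R⊆        : ∀ {z} → z ∈ R → z ∈ R₀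
      covers    : ∀ {z} → z ∈ R₀ → z ∈ K ⊎ z ∈ R
      size      : length K ≤ length K₀ + length R₀

  component : ∀ n {K R} → length R ≤ n → ConnectedList _~_ K → Component K R
  component n {K} {R} bound conn
    with search R (λ {r} _ → touches r)
    where
    touches : ∀ r → (∀ {k} → k ∈ K → k ≁ r) ⊎ (∃[ k ] k ∈ K × (r ≡ k ⊎ r ~ k))
    touches r = search K λ {k} _ → related (trichotomy r k)
      where
      related : ∀ {k} → r ≡ k ⊎ r ~ k ⊎ r ≁ k → k ≁ r ⊎ (r ≡ k ⊎ r ~ k)
      related (inj₁ eq)       = inj₂ (inj₁ eq)
      related (inj₂ (inj₁ e)) = inj₂ (inj₂ e)
      related (inj₂ (inj₂ s)) = inj₁ (≁-sym s)
  ... | inj₁ apart = record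
    { connected = conn ; apart = λ k∈K r∈R → apart r∈R k∈K ; extends = id
    ; K⊆ = inj₁ ; R⊆ = id ; covers = inj₂ ; size = m≤m+n (length K) (length R) }
  component zero {R = []} _ _ | inj₂ (_ , () , _)
  component (suc n) {K} {R} bound conn | inj₂ (x , x∈R , k , k∈K , rel) with x ∈? K
  -- The lists may overlap: `looseSkew` starts with `a` alone as `K` and with all of `A`, including
  -- `a`, as `R`.
  ... | yes x∈K = record
    { connected = connected ; apart = apart ; extends = extends
    ; K⊆ = λ z∈ → [ inj₁ , inj₂ ∘ proj₁ ∘ ∈-without⁻ ]′ (K⊆ z∈)
    ; R⊆ = proj₁ ∘ ∈-without⁻ ∘ R⊆ ; covers = cover
    ; size = ≤-trans size (+-monoʳ-≤ (length K) (<⇒≤ (length-without x∈R))) }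
    where
    open Component (component n {K} {without x R} (≤-pred (<-≤-trans (length-without x∈R) bound)) conn)
      renaming (K to K₁; R to R₁)
    cover : ∀ {z} → z ∈ R → z ∈ K₁ ⊎ z ∈ R₁
    cover {z} z∈R with z ≡? x
    ... | yes refl = inj₁ (extends x∈K)
    ... | no z≢x   = covers (∈-without⁺ z∈R z≢x)
  ... | no x∉K = record
    { connected = connected ; apart = apart ; extends = extends ∘ there
    ; K⊆ = λ z∈ → [ (λ { (here refl) → inj₂ x∈R ; (there z∈K) → inj₁ z∈K })
                  , inj₂ ∘ proj₁ ∘ ∈-without⁻ ]′ (K⊆ z∈)
    ; R⊆ = proj₁ ∘ ∈-without⁻ ∘ R⊆ ; covers = cover
    ; size = ≤-trans size (≤-trans (≤-reflexive (sym (+-suc (length K) (length (without x R)))))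
               (+-monoʳ-≤ (length K) (length-without x∈R))) }
    where
    x~k : x ~ k
    x~k = [ (λ { refl → contradiction k∈K x∉K }) , id ]′ rel
    open Component (component n {x ∷ K} {without x R} (≤-pred (<-≤-trans (length-without x∈R) bound))
                     (attach x∉K k∈K x~k conn))
      renaming (K to K₁; R to R₁)
    cover : ∀ {z} → z ∈ R → z ∈ K₁ ⊎ z ∈ R₁
    cover {z} z∈R with z ≡? x
    ... | yes refl = inj₁ (extends (here refl))
    ... | no z≢x   = covers (∈-without⁺ z∈R z≢x)

  -- Pairs of vertices that can be removed from a connected set

  extractFromClique : ∀ {x} {l : List V} → AllPairs _~_ l → x ∈ l →
    ∃[ r ] l ↭ x ∷ r × All (x ~_) r × AllPairs _~_ r
  extractFromClique {l = _ ∷ l} (all ∷ cl) (here refl) = l , refl , all , cl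
  extractFromClique {x} {y ∷ l} (all ∷ cl) (there x∈l)
    with r , l↭ , allr , clr ← extractFromClique cl x∈l
    with y~x ∷ ally ← All-resp-↭ l↭ all =
    y ∷ r , trans (prep y l↭) (swap y x refl) , ~-sym y~x ∷ allr , ally ∷ clr

  clique⇒connected : ∀ {x l} → AllPairs _~_ (x ∷ l) → ConnectedList _~_ (x ∷ l)
  clique⇒connected {x} {[]} _ = single x
  clique⇒connected {x} {y ∷ l} (all ∷ cl) =
    attach (λ x∈l → ~-irrefl (All.lookup all x∈l)) (here refl) (All.lookup all (here refl))
      (clique⇒connected cl)

  ∈-drop : ∀ {l : List V} {x r z} → l ↭ x ∷ r → z ∈ l → z ≢ x → z ∈ r
  ∈-drop l↭ z∈l z≢x with ∈-resp-↭ l↭ z∈l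
  ... | here z≡x  = contradiction z≡x z≢x
  ... | there z∈r = z∈r

  ∈-undrop : ∀ {l : List V} {x r z} → l ↭ x ∷ r → z ∈ r → z ∈ l
  ∈-undrop l↭ z∈r = ∈-resp-↭ (↭-sym l↭) (there z∈r)

  ∈-head : ∀ {l : List V} {x r} → l ↭ x ∷ r → x ∈ l
  ∈-head l↭ = ∈-resp-↭ (↭-sym l↭) (here refl)

  -- Applied in the complement, where `x` and `y` are adjacent in the graph. The field `both`
  -- provides a path between `x` and `y`, either with two edges or with its interior in the
  -- connected rest.
  record RemovablePair (l : List V) : Set where
    field
      {x y}      : V
      {l-x l-y}  : List V
      l↭x        : l ↭ x ∷ l-x
      l↭y        : l ↭ y ∷ l-y
      connected₁ : ConnectedList _~_ l-x
      connected₂ : ConnectedList _~_ l-y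
      x∉l-x      : x ∉ l-x
      y∉l-y      : y ∉ l-y
      x≁y        : x ≁ y
      both       : (∃[ w ] w ∈ l × x ~ w × w ~ y)
                 ⊎ (∃[ r ] l ↭ x ∷ y ∷ r × ConnectedList _~_ r)

  -- Induction on the connection order. If the rest is a clique, the new vertex `z` is paired with a
  -- nonneighbour `v`, and `w` is a common neighbour. Otherwise the rest has a pair `x`, `y`. If `z`
  -- misses one of the two, it is paired with that one, and removing both leaves a set already known
  -- to be connected. If `z` sees both, it is a common neighbour and the pair is kept.
  removablePair : ∀ {l} → ConnectedList _~_ l → AllPairs _~_ l ⊎ RemovablePair l
  removablePair (single x) = inj₁ ([] ∷ [])
  removablePair (attach {z} {w} {l} z∉l w∈l z~w conn) with removablePair conn
  ... | inj₁ clique with search l (λ v∈l → ≢⇒~⊎≁ (λ { refl → z∉l v∈l }))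
  ...   | inj₁ complete = inj₁ (All.tabulate complete ∷ clique)
  ...   | inj₂ (v , v∈l , z≁v)
          with extractFromClique clique v∈l
  ...     | r , l↭ , allv , clr = inj₂ record
            { l↭x = refl ; l↭y = trans (prep z l↭) (swap z v refl)
            ; connected₁ = conn
            ; connected₂ = attach (λ z∈r → z∉l (∈-undrop l↭ z∈r)) w∈r z~w (cliqueAt clr w∈r)
            ; x∉l-x = z∉l
            ; y∉l-y = λ { (here refl) → z∉l v∈l ; (there v∈r) → ~-irrefl (All.lookup allv v∈r) }
            ; x≁y = z≁v
            ; both = inj₁ (w , there w∈l , z~w , ~-sym (All.lookup allv w∈r)) }
            where
            w∈r = ∈-drop l↭ w∈l (λ { refl → exclusive z~w z≁v })
            cliqueAt : ∀ {r} → AllPairs _~_ r → w ∈ r → ConnectedList _~_ r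
            cliqueAt {_ ∷ _} cl _ = clique⇒connected cl
  removablePair (attach {z} {w} {l} z∉l w∈l z~w conn) | inj₂ pair
    with z ~? RemovablePair.y pair | z ~? RemovablePair.x pair
  ... | no ¬z~y | _ = inj₂ record
    { l↭x = refl ; l↭y = trans (prep z l↭y) (swap z y refl)
    ; connected₁ = conn
    ; connected₂ = attach (λ z∈ → z∉l (∈-undrop l↭y z∈))
        (∈-drop l↭y w∈l (λ { refl → ¬z~y z~w })) z~w connected₂
    ; x∉l-x = z∉l
    ; y∉l-y = λ { (here refl) → z∉l (∈-head l↭y) ; (there ∈r) → y∉l-y ∈r }
    ; x≁y = ¬~⇒≁ (λ { refl → z∉l (∈-head l↭y) }) ¬z~y
    ; both = inj₂ (l-y , prep z l↭y , connected₂) }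
    where open RemovablePair pair
  ... | yes z~y | no ¬z~x = inj₂ record
    { l↭x = refl ; l↭y = trans (prep z l↭x) (swap z x refl)
    ; connected₁ = conn
    ; connected₂ = attach (λ z∈ → z∉l (∈-undrop l↭x z∈))
        (∈-drop l↭x w∈l (λ { refl → ¬z~x z~w })) z~w connected₁
    ; x∉l-x = z∉l
    ; y∉l-y = λ { (here refl) → z∉l (∈-head l↭x) ; (there ∈r) → x∉l-x ∈r }
    ; x≁y = ¬~⇒≁ (λ { refl → z∉l (∈-head l↭x) }) ¬z~x
    ; both = inj₂ (l-x , prep z l↭x , connected₁) }
    where open RemovablePair pair
  ... | yes z~y | yes z~x = inj₂ record
    { l↭x = trans (prep z l↭x) (swap z x refl) ; l↭y = trans (prep z l↭y) (swap z y refl)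
    ; connected₁ = attach (λ z∈ → z∉l (∈-undrop l↭x z∈))
        (∈-drop l↭x (∈-head l↭y) (≢-sym (≁⇒≢ x≁y))) z~y connected₁
    ; connected₂ = attach (λ z∈ → z∉l (∈-undrop l↭y z∈))
        (∈-drop l↭y (∈-head l↭x) (≁⇒≢ x≁y)) z~x connected₂
    ; x∉l-x = λ { (here refl) → z∉l (∈-head l↭x) ; (there ∈r) → x∉l-x ∈r }
    ; y∉l-y = λ { (here refl) → z∉l (∈-head l↭y) ; (there ∈r) → y∉l-y ∈r }
    ; x≁y = x≁y
    ; both = inj₁ (z , here refl , ~-sym z~x , z~y) }
    where open RemovablePair pair

  NoOddPath : (C X : V → Set) → Set
  NoOddPath C X = ∀ {p lo hi} → IsPath p lo hi → X (p lo) → X (p hi) → p lo ≁ p hi →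
    Interior C p lo hi → parity lo ≡ parity hi

record BalancedPair {V} (𝔾 : BergeRelation V) (C X : V → Set) : Set where
  field
    no-odd-path     : Paths.NoOddPath 𝔾 C X
    no-odd-antipath : Paths.NoOddPath (dual 𝔾) X C

dualBalanced : ∀ {V} {𝔾 : BergeRelation V} {C X} → BalancedPair 𝔾 C X → BalancedPair (dual 𝔾) X C
dualBalanced bal = record { no-odd-path = no-odd-antipath ; no-odd-antipath = no-odd-path }
  where open BalancedPair bal

-- Shifts the indices by one, because a path that starts at index 0 leaves no room for `extendˡ`.
prepend : ∀ {V : Set} → V → (ℕ → V) → ℕ → V
prepend x q zero    = x
prepend x q (suc k) = q k

prependPath : ∀ {V : Set} {R S : Rel V 0ℓ} {q m} → InducedPath R S q 0 m → ∀ {x} → R x (q 0) →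
  (∀ {k} → 0 < k → k ≤ m → S x (q k)) → InducedPath R S (prepend x q) 0 (suc m)
prependPath {R = R} {S} {q} {m} Q {x} Rx Sx = inducedPath z≤n edge′ chord′
  where
  edge′ : ∀ {k} → 0 ≤ k → k < suc m → R (prepend x q k) (q k)
  edge′ {zero}  _ _       = Rx
  edge′ {suc k} _ (s≤s u) = edge Q z≤n u
  chord′ : ∀ {k l} → 0 ≤ k → suc k < l → l ≤ suc m → S (prepend x q k) (prepend x q l)
  chord′ {zero}  {suc l} _ (s≤s k<l) (s≤s u) = Sx k<l u
  chord′ {suc k} {suc l} _ (s≤s k<l) (s≤s u) = chord Q z≤n k<l u

-- The Roussel-Rubio lemma: complete edges and short paths

∧-true : ∀ {a b} → a ∧ b ≡ true → a ≡ true × b ≡ true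
∧-true {true} {true} _ = refl , refl

_≟ᵇ_ : (a b : Bool) → a ≡ b ⊎ a ≡ not b
false ≟ᵇ false = inj₁ refl
false ≟ᵇ true  = inj₂ refl
true  ≟ᵇ false = inj₂ refl
true  ≟ᵇ true  = inj₁ refl

≡-not : ∀ {a} → ¬ (a ≡ not a)
≡-not {false} ()
≡-not {true}  ()

-- The Roussel–Rubio lemma for a path p whose interior lies in C: for an
-- anticonnected X balanced against C that is complete to both ends of p, the number
-- of X-complete edges of p has the parity of the length of p.
module RousselRubio {V : Set} (𝔾 : BergeRelation V) (p : ℕ → V) (C : V → Set) where
  open BergeRelation 𝔾
  open Paths 𝔾
  private module Dual = Paths (dual 𝔾)

  -- The number `k` stands for the edge between `p k` and `p (suc k)`. The values are Booleans so
  -- that edges can be counted modulo 2.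
  completeEdge : V → ℕ → Bool
  completeEdge x k = does (x ~? p k) ∧ does (x ~? p (suc k))

  allComplete noneComplete : List V → ℕ → Bool
  allComplete []      k = true
  allComplete (x ∷ X) k = completeEdge x k ∧ allComplete X k
  noneComplete []      k = true
  noneComplete (x ∷ X) k = not (completeEdge x k) ∧ noneComplete X k

  does⇒~ : ∀ {u v} → does (u ~? v) ≡ true → u ~ v
  does⇒~ {u} {v} eq with u ~? v
  ... | yes u~v = u~v
  does⇒~ () | no _

  ~⇒does : ∀ {u v} → u ~ v → does (u ~? v) ≡ true
  ~⇒does {u} {v} u~v with u ~? v
  ... | yes _   = refl
  ... | no ¬u~v = contradiction u~v ¬u~v

  allComplete⇒Complete : ∀ X {k} → allComplete X k ≡ true → Complete X (p k) × Complete X (p (suc k))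
  allComplete⇒Complete [] _ = (λ ()) , (λ ())
  allComplete⇒Complete (x ∷ X) {k} eq
    with e , es ← ∧-true {completeEdge x k} eq
    with l , r ← ∧-true {does (x ~? p k)} e | ls , rs ← allComplete⇒Complete X es =
    (λ { (here refl) → does⇒~ l ; (there y∈) → ls y∈ }) ,
    (λ { (here refl) → does⇒~ r ; (there y∈) → rs y∈ })

  Complete⇒allComplete : ∀ X {k} → Complete X (p k) → Complete X (p (suc k)) → allComplete X k ≡ true
  Complete⇒allComplete [] _ _ = refl
  Complete⇒allComplete (x ∷ X) l r
    rewrite ~⇒does (l (here refl)) | ~⇒does (r (here refl)) =
    Complete⇒allComplete X (l ∘ there) (r ∘ there)

  noneComplete-true : ∀ X {k} → (∀ {x} → x ∈ X → ¬ (x ~ p k × x ~ p (suc k))) → noneComplete X k ≡ true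
  noneComplete-true [] _ = refl
  noneComplete-true (x ∷ X) {k} none with x ~? p k | x ~? p (suc k)
  ... | yes l | yes r = contradiction (l , r) (none (here refl))
  ... | yes _ | no _  = noneComplete-true X (none ∘ there)
  ... | no _  | _     = noneComplete-true X (none ∘ there)

  noneComplete-false : ∀ X {k x} → x ∈ X → x ~ p k → x ~ p (suc k) → noneComplete X k ≡ false
  noneComplete-false (x ∷ X) (here refl) l r rewrite ~⇒does l | ~⇒does r = refl
  noneComplete-false (y ∷ X) {k} (there x∈) l r
    rewrite noneComplete-false X {k} x∈ l r with not (completeEdge y k)
  ... | false = refl
  ... | true  = refl

  record Fit (X : List V) : Set where
    field
      anticonnected : ConnectedList _≁_ X
      disjoint      : ∀ {x c} → x ∈ X → C c → x ≢ c
      balanced      : BalancedPair 𝔾 C (_∈ X)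
    open BalancedPair balanced public

  restrict : ∀ {X Y} → Fit X → (∀ {x} → x ∈ Y → x ∈ X) → ConnectedList _≁_ Y → Fit Y
  restrict fit Y⊆X conn = record
    { anticonnected = conn
    ; disjoint = λ y∈Y → disjoint (Y⊆X y∈Y)
    ; balanced = record
      { no-odd-path = λ P l h → no-odd-path P (Y⊆X l) (Y⊆X h)
      ; no-odd-antipath = λ P l h ends int → no-odd-antipath P l h ends (λ a b → Y⊆X (int a b)) }
    }
    where open Fit fit

  -- The case of the lemma in which no interior vertex is `X`-complete. With at least two edges,
  -- such a path has no `X`-complete edge, so its length has to be even.
  EvenGaps : List V → Set
  EvenGaps X = ∀ {lo hi} → IsPath p lo hi → suc lo < hi →
    Complete X (p lo) → Complete X (p hi) → Interior C p lo hi →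
    Interior (¬_ ∘ Complete X) p lo hi → parity lo ≡ parity hi

  -- In a path with at least two edges, every edge has an interior end.
  one-is-interior : ∀ {lo hi k} {T : V → Set} → suc lo < hi → lo ≤ k → k < hi →
    T (p k) → T (p (suc k)) → ¬ Interior (¬_ ∘ T) p lo hi
  one-is-interior 1+lo<hi lo≤k k<hi Tk Tk′ none with m≤n⇒m<n∨m≡n lo≤k
  ... | inj₁ lo<k = none lo<k k<hi Tk
  ... | inj₂ refl = none ≤-refl 1+lo<hi Tk′

  -- The path is cut at its `X`-complete vertices. A piece that is a single edge adds one to the
  -- count and to the length; a longer piece adds nothing to the count and, by `EvenGaps`, an even
  -- number to the length. So `xorSum f k xor parity k` agrees at consecutive cuts.
  countComplete : ∀ {X} → EvenGaps X → ∀ {lo hi} → IsPath p lo hi → lo < hi →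
    Complete X (p lo) → Complete X (p hi) → Interior C p lo hi →
    count (allComplete X) lo hi ≡ parity lo xor parity hi
  countComplete {X} even {lo} {hi} P lo<hi Xlo Xhi inC =
    rearrange (xorSum f lo) (parity lo) (xorSum f hi) (parity hi)
      (gaps (λ k → complete? X (p k)) (λ k → xorSum f k xor parity k) lo<hi
        (λ {x} → Xlo {x}) (λ {x} → Xhi {x}) gap)
    where
    f = allComplete X
    rearrange : ∀ a b c d → a xor b ≡ c xor d → a xor c ≡ b xor d
    rearrange false b false d     eq = sym (≡-trans (cong (_xor d) eq) (xor-same d))
    rearrange false b true  false refl = refl
    rearrange false b true  true  refl = refl
    rearrange true  false c false eq = cong not (lemma c eq)
      where
      lemma : ∀ c → true ≡ c xor false → c ≡ true
      lemma true _ = refl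
    rearrange true  false false true  eq = refl
    rearrange true  true  true  true  eq = refl
    rearrange true  true  false false eq = refl
    gap : ∀ i j → lo ≤ i → i < j → j ≤ hi → Complete X (p i) → Complete X (p j) →
      (∀ k → i < k → k < j → ¬ Complete X (p k)) → xorSum f i xor parity i ≡ xorSum f j xor parity j
    gap i j lo≤i i<j j≤hi Xi Xj none with m≤n⇒m<n∨m≡n i<j
    ... | inj₂ refl rewrite Complete⇒allComplete X {i} Xi Xj = lemma (xorSum f i) (parity i)
      where
      lemma : ∀ a b → a xor b ≡ not a xor not b
      lemma false false = refl
      lemma false true  = refl
      lemma true  b     = refl
    ... | inj₁ 1+i<j = cong₂ _xor_
      (xor-≡⇒≡ {xorSum f i} {xorSum f j} (count-false {f} (<⇒≤ i<j) no-edge))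
      (even (subpath P lo≤i (<⇒≤ i<j) j≤hi) 1+i<j Xi Xj
        (λ l u → inC (≤-<-trans lo≤i l) (<-≤-trans u j≤hi)) (λ {k} → none k))
      where
      no-edge : ∀ k → i ≤ k → k < j → f k ≡ false
      no-edge k l u with f k in eq
      ... | false = refl
      ... | true with Xk , Xk′ ← allComplete⇒Complete X eq =
        contradiction (λ {k} → none k) (one-is-interior {T = Complete X} 1+i<j l u Xk Xk′)

  nonneighbour : ∀ {X} → Fit X → ∀ {v} → C v → ¬ Complete X v → ∃[ x ] x ∈ X × v ≁ x
  nonneighbour {X} fit Cv ¬Xv
    with search X (λ x∈X → ≢⇒~⊎≁ (Fit.disjoint fit x∈X Cv))
  ... | inj₁ all             = contradiction (λ {x} → all {x}) ¬Xv
  ... | inj₂ (x , x∈X , x≁v) = x , x∈X , ≁-sym x≁v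

  -- An antipath through `X` between the two interior vertices is even by balance. The two ends of
  -- the path are nonadjacent, and each of them misses exactly one end of the antipath and sees the
  -- rest of it; so together they close it to an antihole of odd length.
  no-three-edge-path : ∀ {X lo} → Fit X → IsPath p lo (3 + lo) →
    Complete X (p lo) → Complete X (p (3 + lo)) → Interior C p lo (3 + lo) →
    ¬ Interior (¬_ ∘ Complete X) p lo (3 + lo)
  no-three-edge-path {X} {lo} fit P X₀ X₃ inC none
    with C₁ ← inC {1 + lo} ≤-refl (s≤s (n≤1+n (1 + lo)))
       | C₂ ← inC {2 + lo} (n≤1+n (1 + lo)) ≤-refl
    with x₁ , x₁∈ , p₁≁x₁ ← nonneighbour fit C₁ (none ≤-refl (s≤s (n≤1+n (1 + lo))))
       | x₂ , x₂∈ , p₂≁x₂ ← nonneighbour fit C₂ (none (n≤1+n (1 + lo)) ≤-refl)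
       | p₁~p₂ ← edge P {1 + lo} (n≤1+n lo) (s≤s (s≤s (n≤1+n lo)))
    with q , m , Q , q₀ , qₘ , inX ← Dual.pathThrough (Dual.walkInList (Fit.anticonnected fit))
           (λ p₁∈ → Fit.disjoint fit p₁∈ C₁ refl) (λ p₂∈ → Fit.disjoint fit p₂∈ C₂ refl)
           (~⇒≢ p₁~p₂) x₂∈ p₂≁x₂ x₁∈ p₁≁x₁ = ≡-not (≡-trans (sym even) closed)
    where
    open Fit fit
    ends : q 0 ~ q m
    ends = subst₂ _~_ (sym q₀) (sym qₘ) (~-sym p₁~p₂)
    even : parity 0 ≡ parity m
    even = no-odd-antipath Q (subst C (sym q₀) C₂) (subst C (sym qₘ) C₁) ends inX
    Q′ = extendʳ Q {p (3 + lo)} (subst (_≁ p (3 + lo)) (sym qₘ) (chord P (n≤1+n lo) ≤-refl ≤-refl)) λ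
      { {zero}  _ _ → subst (_~ p (3 + lo)) (sym q₀) (edge P (≤-trans (n≤1+n lo) (n≤1+n (1 + lo))) ≤-refl)
      ; {suc k} _ u → X₃ (inX (s≤s z≤n) u) }
    old : ∀ {k} → k ≤ m → update q (suc m) (p (3 + lo)) k ≡ q k
    old k≤m = update-≢ q _ (<⇒≢ (s≤s k≤m))
    closed : parity 0 ≡ parity (suc m)
    closed = antiholes-even Q′ (s≤s (≤-trans (s≤s z≤n) (<⇒≤ (Dual.nonadjacent-ends Q ends))))
      (subst (p lo ≁_) (sym (≡-trans (old z≤n) q₀)) (chord P ≤-refl ≤-refl (n≤1+n (2 + lo))))
      (subst (p lo ≁_) (sym (update-≡ q (suc m) _)) (chord P ≤-refl (s≤s (n≤1+n (1 + lo))) ≤-refl))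
      λ {k} l u → subst (p lo ~_) (sym (old (≤-pred u))) (interior l (≤-pred u))
      where
      interior : ∀ {k} → 0 < k → k ≤ m → p lo ~ q k
      interior l u with m≤n⇒m<n∨m≡n u
      ... | inj₁ k<m  = ~-sym (X₀ (inX l k<m))
      ... | inj₂ refl = subst (p lo ~_) (sym qₘ) (edge P ≤-refl (s≤s (≤-trans (n≤1+n lo) (n≤1+n (1 + lo)))))

  -- The Roussel-Rubio lemma for stable sets

  module StablePart {X : List V} (fit : Fit X) (stable : AllPairs _≁_ X) {lo hi : ℕ}
    (P : IsPath p lo hi) (1+lo<hi : suc lo < hi)
    (Xlo : Complete X (p lo)) (Xhi : Complete X (p hi))
    (inC : Interior C p lo hi) (none : Interior (¬_ ∘ Complete X) p lo hi)
    (odd : count (λ _ → true) lo hi ≡ true)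
    (ih : ∀ {T} → (∀ {x} → x ∈ T → x ∈ X) → ConnectedList _≁_ T → length T < length X →
          count (allComplete T) lo hi ≡ true) where
    open Fit fit

    private
      lo<hi = <⇒≤ 1+lo<hi

    stable-≁ : ∀ {x y} {l} → AllPairs _≁_ l → x ∈ l → y ∈ l → x ≢ y → x ≁ y
    stable-≁ _          (here refl) (here refl) x≢y = contradiction refl x≢y
    stable-≁ (all ∷ _)  (here refl) (there y∈)  _   = All.lookup all y∈
    stable-≁ (all ∷ _)  (there x∈)  (here refl) _   = ≁-sym (All.lookup all x∈)
    stable-≁ (_ ∷ rest) (there x∈)  (there y∈)  x≢y = stable-≁ rest x∈ y∈ x≢y

    Touched : ℕ → Set
    Touched k = ∃[ x ] x ∈ X × x ~ p k

    touched? : ∀ k → Dec (Touched k)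
    touched? k with search X (λ {x} _ → dec x)
      where
      dec : ∀ x → ¬ (x ~ p k) ⊎ x ~ p k
      dec x with x ~? p k
      ... | yes r = inj₂ r
      ... | no ¬r = inj₁ ¬r
    ... | inj₂ t   = yes t
    ... | inj₁ all = no λ { (x , x∈X , r) → all x∈X r }

    avoids : ∀ {x k} → x ∈ X → lo ≤ k → k ≤ hi → ¬ (x ~ p k) → lo < k × k < hi × x ≁ p k
    avoids {x} {k} x∈X l u ¬r with m≤n⇒m<n∨m≡n l | m≤n⇒m<n∨m≡n u
    ... | inj₂ refl | _         = contradiction (Xlo x∈X) ¬r
    ... | inj₁ _    | inj₂ refl = contradiction (Xhi x∈X) ¬r
    ... | inj₁ lo<k | inj₁ k<hi = lo<k , k<hi , ¬~⇒≁ (disjoint x∈X (inC lo<k k<hi)) ¬r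

    -- If neither `x` nor `y` sees both positions, then `x`, `p i`, ..., `p j`, `y` is an induced
    -- path with nonadjacent ends in `X`, hence even. Its interior lies in `C`: as `X` is complete
    -- to `p lo` and `p hi`, a position missed by `x` or `y` is interior.
    consecutive : ∀ {i j} → lo ≤ i → i < j → j ≤ hi → Touched i → Touched j →
      (∀ k → i < k → k < j → ¬ Touched k) →
      (∃[ x ] x ∈ X × x ~ p i × x ~ p j) ⊎ parity i ≡ parity j
    consecutive {i} {j} lo≤i i<j j≤hi (x , x∈X , x~i) (y , y∈X , y~j) untouched
      with x ~? p j | y ~? p i
    ... | yes x~j | _       = inj₁ (x , x∈X , x~i , x~j)
    ... | no _    | yes y~i = inj₁ (y , y∈X , y~i , y~j)
    ... | no ¬x~j | no ¬y~i
      with lo<i , _ , y≁i ← avoids y∈X lo≤i (<⇒≤ (<-≤-trans i<j j≤hi)) ¬y~i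
         | _ , j<hi , x≁j ← avoids x∈X (≤-trans lo≤i (<⇒≤ i<j)) j≤hi ¬x~j
      -- As `i` exceeds `lo`, it has a predecessor `i′`, the index at which `x` is placed.
      with s≤s {n = i′} _ ← lo<i =
      inj₂ (≡-trans (cong not detour) (not-involutive (parity j)))
      where
      x≢y : x ≢ y
      x≢y refl = ¬x~j y~j
      x≁y = stable-≁ stable x∈X y∈X x≢y
      off-path : ∀ {z k} → z ∈ X → i < k → k < j → z ≁ p k
      off-path z∈X l u = ¬~⇒≁ (disjoint z∈X (inC (≤-<-trans lo≤i l) (<-≤-trans u j≤hi)))
        λ r → untouched _ l u (_ , z∈X , r)
      x-off : ∀ {k} → i < k → k ≤ j → x ≁ p k
      x-off l u with m≤n⇒m<n∨m≡n u
      ... | inj₁ k<j  = off-path x∈X l k<j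
      ... | inj₂ refl = x≁j
      q₁ = update p i′ x
      q₁-old : ∀ {k} → i′ < k → q₁ k ≡ p k
      q₁-old l = update-≢ p x (≢-sym (<⇒≢ l))
      y-off : ∀ {k} → i′ ≤ k → k < j → q₁ k ≁ y
      y-off l u with m≤n⇒m<n∨m≡n l
      ... | inj₂ refl = subst (_≁ y) (sym (update-≡ p i′ x)) x≁y
      ... | inj₁ i≤k with m≤n⇒m<n∨m≡n i≤k
      ...   | inj₂ refl = subst (_≁ y) (sym (q₁-old i≤k)) (≁-sym y≁i)
      ...   | inj₁ i<k  = subst (_≁ y) (sym (q₁-old i≤k)) (≁-sym (off-path y∈X i<k u))
      q₂ = update q₁ (suc j) y
      q₂-old : ∀ {k} → k ≤ j → q₂ k ≡ q₁ k
      q₂-old u = update-≢ q₁ y (<⇒≢ (s≤s u))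
      Q₂ : IsPath q₂ i′ (suc j)
      Q₂ = extendʳ (extendˡ (subpath P lo≤i (<⇒≤ i<j) j≤hi) x~i x-off)
        (subst (_~ y) (sym (q₁-old (<⇒≤ i<j))) (~-sym y~j)) y-off
      q₂-start : q₂ i′ ≡ x
      q₂-start = ≡-trans (q₂-old (<⇒≤ (<⇒≤ i<j))) (update-≡ p i′ x)
      q₂-end : q₂ (suc j) ≡ y
      q₂-end = update-≡ q₁ (suc j) y
      detour : parity i′ ≡ not (parity j)
      detour = no-odd-path Q₂ (subst (_∈ X) (sym q₂-start) x∈X) (subst (_∈ X) (sym q₂-end) y∈X)
        (subst₂ _≁_ (sym q₂-start) (sym q₂-end) x≁y)
        λ l u → subst C (sym (≡-trans (q₂-old (≤-pred u)) (q₁-old l)))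
          (inC (<-≤-trans lo<i l) (≤-<-trans (≤-pred u) j<hi))

    -- Two consecutive touched positions either bound an edge that is complete
    -- to some vertex of X, or are an even number of untouched edges apart.
    countNone : count (noneComplete X) lo hi ≡ false
    countNone = ≡-trans (cong (xorSum h lo xor_) (sym constant)) (xor-same (xorSum h lo))
      where
      h = noneComplete X
      x₀∈X : ∃[ x ] x ∈ X
      x₀∈X with anticonnected
      ... | single x       = x , here refl
      ... | attach _ _ _ _ = _ , here refl
      gap : ∀ i j → lo ≤ i → i < j → j ≤ hi → Touched i → Touched j →
        (∀ k → i < k → k < j → ¬ Touched k) → xorSum h i ≡ xorSum h j
      gap i j lo≤i i<j j≤hi Ti Tj untouched
        with consecutive lo≤i i<j j≤hi Ti Tj untouched | m≤n⇒m<n∨m≡n i<j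
      ... | inj₂ eq | inj₂ refl = contradiction eq ≡-not
      ... | inj₁ (x , x∈X , x~i , x~j) | inj₂ refl
            rewrite noneComplete-false X {i} x∈X x~i x~j = refl
      ... | r | inj₁ 1+i<j = xor-≡⇒≡ {xorSum h i} {xorSum h j}
              (≡-trans (count-cong {h} (<⇒≤ i<j) all-none)
              (≡-trans (count-true i j) (≡-trans (cong (_xor parity j) (even r)) (xor-same (parity j)))))
        where
        all-none : ∀ k → i ≤ k → k < j → h k ≡ true
        all-none k l u = noneComplete-true X λ {x} x∈X (r , r′) →
          one-is-interior {T = λ v → x ~ v} 1+i<j l u r r′
            (λ {k} l u x~k → untouched k l u (x , x∈X , x~k))
        even : (∃[ x ] x ∈ X × x ~ p i × x ~ p j) ⊎ parity i ≡ parity j → parity i ≡ parity j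
        even (inj₂ eq) = eq
        -- Here `x` closes the untouched stretch to a hole.
        even (inj₁ (x , x∈X , x~i , x~j)) =
          holes-even (subpath P lo≤i (<⇒≤ i<j) j≤hi) 1+i<j x~i x~j
            λ l u → ¬~⇒≁ (disjoint x∈X (inC (≤-<-trans lo≤i l) (<-≤-trans u j≤hi)))
              λ r → untouched _ l u (x , x∈X , r)
      constant : xorSum h lo ≡ xorSum h hi
      constant = gaps touched? (xorSum h) lo<hi
        (_ , proj₂ x₀∈X , Xlo (proj₂ x₀∈X)) (_ , proj₂ x₀∈X , Xhi (proj₂ x₀∈X)) gap

    -- Inclusion–exclusion: mixed T U marks the edges complete to T and to no
    -- vertex of U.  As the T-complete edges are odd in number for every proper
    -- subset T, the edges marked by mixed T U are even in number unless U is empty.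
    mixed : List V → List V → ℕ → Bool
    mixed T U k = allComplete T k ∧ noneComplete U k

    -- An edge marked by `mixed T U` is either complete to `u` or not.
    mixed-split : ∀ T u U → count (mixed T (u ∷ U)) lo hi ≡
      count (mixed T U) lo hi xor count (mixed (u ∷ T) U) lo hi
    mixed-split T u U = ≡-trans
      (count-cong (<⇒≤ lo<hi) λ k _ _ → lemma (allComplete T k) (completeEdge u k) (noneComplete U k))
      (count-xor (mixed T U) (mixed (u ∷ T) U) lo hi)
      where
      lemma : ∀ a e n → a ∧ (not e ∧ n) ≡ (a ∧ n) xor ((e ∧ a) ∧ n)
      lemma false false n     = refl
      lemma false true  n     = refl
      lemma true  false false = refl
      lemma true  false true  = refl
      lemma true  true  false = refl
      lemma true  true  true  = refl

    mixed-[] : ∀ T → count (mixed T []) lo hi ≡ count (allComplete T) lo hi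
    mixed-[] T = count-cong (<⇒≤ lo<hi) λ k _ _ → ∧-identityʳ (allComplete T k)

    -- Since `_≁_` is irreflexive, `T` and `U` are also disjoint and free of repetitions. The
    -- nonadjacency across them keeps `T` stable, and hence anticonnected, when a vertex of `U`
    -- moves to it.
    record Split (T U : List V) : Set where
      field
        stableT : AllPairs _≁_ T
        stableU : AllPairs _≁_ U
        across  : All (λ u → All (u ≁_) T) U
        T⊆X     : ∀ {x} → x ∈ T → x ∈ X
        U⊆X     : ∀ {x} → x ∈ U → x ∈ X

    moveSplit : ∀ {T u U} → Split T (u ∷ U) → Split (u ∷ T) U
    moveSplit record { stableT = sT ; stableU = u≁U ∷ sU ; across = u≁T ∷ U≁T ; T⊆X = T⊆X ; U⊆X = U⊆X } = record
      { stableT = u≁T ∷ sT ; stableU = sU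
      ; across = All.zipWith (λ (u≁v , v≁T) → ≁-sym u≁v ∷ v≁T) (u≁U , U≁T)
      ; T⊆X = λ { (here refl) → U⊆X (here refl) ; (there x∈T) → T⊆X x∈T }
      ; U⊆X = U⊆X ∘ there }

    dropSplit : ∀ {T u U} → Split T (u ∷ U) → Split T U
    dropSplit record { stableT = sT ; stableU = _ ∷ sU ; across = _ ∷ U≁T ; T⊆X = T⊆X ; U⊆X = U⊆X } = record
      { stableT = sT ; stableU = sU ; across = U≁T ; T⊆X = T⊆X ; U⊆X = U⊆X ∘ there }

    -- For nonempty `U`, `mixed-split` yields two counts with the same value, which cancel. For
    -- empty `U`, the count is odd by `ih`, or by `odd` if `T` is empty as well.
    count-proper : ∀ T U → Split T U → length T + length U < length X →
      count (mixed T U) lo hi ≡ null U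
    count-proper [] [] _ _ = odd
    count-proper (t ∷ T) [] s lt = ≡-trans (mixed-[] (t ∷ T))
      (ih (Split.T⊆X s) (Dual.clique⇒connected (Split.stableT s))
        (subst (_< length X) (+-identityʳ _) lt))
    count-proper T (u ∷ U) s lt = ≡-trans (mixed-split T u U) (≡-trans
      (cong₂ _xor_
        (count-proper T U (dropSplit s) (<-trans (+-monoʳ-< (length T) ≤-refl) lt))
        (count-proper (u ∷ T) U (moveSplit s) (subst (_< length X) (+-suc (length T) (length U)) lt)))
      (xor-same (null U)))

    -- The vertices of `U` move to `T` one by one. In `mixed-split` the count for `T` and `U`
    -- without `u` is given by `count-proper`, so the known parity passes on to `u ∷ T` and `U`. In
    -- the end an odd number of edges is complete to all of `X`.
    exhaust : ∀ T U → Split T U → length T + length U ≤ length X →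
      (∀ {x} → x ∈ X → x ∈ T ⊎ x ∈ U) → count (mixed T U) lo hi ≡ null U →
      ∃[ T ] count (allComplete T) lo hi ≡ true × (∀ {x} → x ∈ X → x ∈ T)
    exhaust T [] _ _ cover eq = T , ≡-trans (sym (mixed-[] T)) eq , λ x∈X → [ id , (λ ()) ]′ (cover x∈X)
    exhaust T (u ∷ U) s le cover eq = exhaust (u ∷ T) U (moveSplit s)
      (subst (_≤ length X) (+-suc (length T) (length U)) le)
      (λ x∈X → shiftCover (cover x∈X))
      (sym (xor-≡⇒≡ (≡-trans (cong (_xor count (mixed (u ∷ T) U) lo hi)
        (sym (count-proper T U (dropSplit s) (<-≤-trans (+-monoʳ-< (length T) ≤-refl) le))))
        (≡-trans (sym (mixed-split T u U)) eq))))
      where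
      shiftCover : ∀ {x} → x ∈ T ⊎ x ∈ (u ∷ U) → x ∈ (u ∷ T) ⊎ x ∈ U
      shiftCover (inj₁ x∈T)          = inj₁ (there x∈T)
      shiftCover (inj₂ (here refl))  = inj₁ (here refl)
      shiftCover (inj₂ (there x∈U)) = inj₂ x∈U

    absurd : ⊥
    absurd with exhaust [] X
        record { stableT = [] ; stableU = stable ; across = All.tabulate λ _ → [] ; T⊆X = λ () ; U⊆X = id }
        ≤-refl inj₂ (≡-trans countNone (nonempty anticonnected))
      where
      nonempty : ∀ {X} → ConnectedList _≁_ X → false ≡ null X
      nonempty (single _)       = refl
      nonempty (attach _ _ _ _) = refl
    ... | T , eq , X⊆T with k , l , u , ek ← count≡true⇒∃ (<⇒≤ lo<hi) eq
      with Tk , Tk′ ← allComplete⇒Complete T ek =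
      one-is-interior {T = Complete X} 1+lo<hi l u (Tk ∘ X⊆T) (Tk′ ∘ X⊆T) none

  -- The Roussel-Rubio lemma for sets that are not stable

  missing : ∀ {X x r} → Fit X → X ↭ x ∷ r → ∀ {v} → C v → Complete r v → ¬ Complete X v → x ≁ v
  missing {X} {x} {r} fit X↭ {v} Cv rv ¬Xv =
    ¬~⇒≁ (Fit.disjoint fit (∈-head X↭) Cv) λ x~v → ¬Xv λ y∈X → complete x~v (∈-resp-↭ X↭ y∈X)
    where
    complete : x ~ v → ∀ {y} → y ∈ (x ∷ r) → y ~ v
    complete x~v (here refl) = x~v
    complete x~v (there y∈r) = rv y∈r

  -- `Q` is an antipath inside `X` between the adjacent vertices `x` and `y`. A vertex `a` that
  -- misses only `x` and a vertex `b` that misses only `y` prolong it at its two ends, so the parity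
  -- of `m` is determined by whether `a` and `b` are adjacent.
  module Antihole {X x y q m} (fit : Fit X) {l-x l-y : List V} (X↭x : X ↭ x ∷ l-x) (X↭y : X ↭ y ∷ l-y)
    (Q : Dual.IsPath q 0 m) (q₀ : q 0 ≡ x) (qₘ : q m ≡ y) (x~y : x ~ y)
    (inX : Interior (_∈ X) q 0 m) where
    open Fit fit

    1<m : 1 < m
    1<m = Dual.nonadjacent-ends Q (subst₂ _~_ (sym q₀) (sym qₘ) x~y)

    in-X : ∀ {k} → k ≤ m → q k ∈ X
    in-X {zero}  _ = subst (_∈ X) (sym q₀) (∈-head X↭x)
    in-X {suc k} u with m≤n⇒m<n∨m≡n u
    ... | inj₁ k<m  = inX (s≤s z≤n) k<m
    ... | inj₂ refl = subst (_∈ X) (sym qₘ) (∈-head X↭y)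

    in-l-x : ∀ {k} → 0 < k → k ≤ m → q k ∈ l-x
    in-l-x l u = ∈-drop X↭x (in-X u) λ eq → Dual.path-injective Q z≤n l u (≡-trans q₀ (sym eq))

    in-l-y : ∀ {k} → k < m → q k ∈ l-y
    in-l-y u = ∈-drop X↭y (in-X (<⇒≤ u)) λ eq → Dual.path-injective Q z≤n u ≤-refl (≡-trans eq (sym qₘ))

    module _ {a b} (x≁a : x ≁ a) (y≁b : y ≁ b) (l-x~a : Complete l-x a) (l-y~b : Complete l-y b) where

      private
        Q₁ : Dual.IsPath (prepend a q) 0 (suc m)
        Q₁ = prependPath Q (subst (a ≁_) (sym q₀) (≁-sym x≁a)) λ l u → ~-sym (l-x~a (in-l-x l u))
        b-off : ∀ {k} → 0 < k → k < suc m → b ~ prepend a q k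
        b-off {suc k} _ (s≤s u) = ~-sym (l-y~b (in-l-y u))

      -- The antipath with `a` and `b` is an antihole on `m + 3` vertices.
      nonadjacent⇒odd : a ≁ b → parity m ≡ true
      nonadjacent⇒odd a≁b = not-injective (sym (antiholes-even Q₁ (≤-trans 1<m (n≤1+n m))
        (≁-sym a≁b) (subst (b ≁_) (sym qₘ) (≁-sym y≁b)) b-off))

      -- The antipath prolonged by `a` and `b` has length `m + 2`, ends in `C` and interior in `X`,
      -- so balance applies.
      adjacent⇒even : C a → C b → a ~ b → parity m ≡ false
      adjacent⇒even Ca Cb a~b = ≡-trans (sym (not-involutive (parity m))) (sym
        (no-odd-antipath Q₂ Ca (subst C (sym end) Cb) (subst (a ~_) (sym end) a~b)
          λ { {suc k} _ (s≤s (s≤s u)) →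
              subst (_∈ X) (sym (update-≢ (prepend a q) b (<⇒≢ (s≤s (s≤s u))))) (in-X u) }))
        where
        Q₂ : Dual.IsPath (update (prepend a q) (suc (suc m)) b) 0 (suc (suc m))
        Q₂ = extendʳ Q₁ (subst (_≁ b) (sym qₘ) y≁b) λ
          { {zero} _ _ → a~b ; {suc k} _ u → ~-sym (b-off (s≤s z≤n) u) }
        end = update-≡ (prepend a q) (suc (suc m)) b

    missed⇒even : ∀ {z} → x ≁ z → y ≁ z → (∀ {k} → 0 < k → k < m → q k ~ z) → parity m ≡ false
    missed⇒even {z} x≁z y≁z inner = sym (antiholes-even Q 1<m
      (subst (z ≁_) (sym q₀) (≁-sym x≁z)) (subst (z ≁_) (sym qₘ) (≁-sym y≁z)) λ l u → ~-sym (inner l u))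

  -- An interior vertex with `B` is neither end of an edge with two interior `A`-ends, so it is at
  -- distance at least two from one of them. If the `A`-edge is the first or last edge of the path,
  -- it has one interior end, and `long` leaves enough room for an end of the `B`-edge away from it.
  distant : ∀ {lo hi} {A B : ℕ → Set} → 5 + lo ≤ hi →
    (∀ {k} → lo < k → k < hi → A k → B k → ⊥) →
    ∀ {k l} → lo ≤ k → k < hi → A k → A (suc k) → lo ≤ l → l < hi → B l → B (suc l) →
    ∃[ i ] ∃[ j ] (lo < i × i < hi) × (lo < j × j < hi) × A i × B j × (suc i < j ⊎ suc j < i)
  distant {lo} {hi} {A} {B} long clash {k} {l} lo≤k k<hi Ak Ak′ lo≤l l<hi Bl Bl′
    with m≤n⇒m<n∨m≡n lo≤k | m≤n⇒m<n∨m≡n k<hi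
  ... | inj₁ lo<k | inj₁ 1+k<hi = pick
    where
    from : ∀ {j} → lo < j → j < hi → B j →
      ∃[ i ] ∃[ j ] (lo < i × i < hi) × (lo < j × j < hi) × A i × B j × (suc i < j ⊎ suc j < i)
    from {j} lo<j j<hi Bj with <-cmp j k
    ... | tri< j<k _ _ = suc k , j , (m≤n⇒m≤1+n lo<k , 1+k<hi) , (lo<j , j<hi) , Ak′ , Bj , inj₂ (s≤s j<k)
    ... | tri≈ _ refl _ = ⊥-elim (clash lo<j j<hi Ak Bj)
    ... | tri> _ _ k<j with m≤n⇒m<n∨m≡n k<j
    ...   | inj₁ 1+k<j = k , j , (lo<k , k<hi) , (lo<j , j<hi) , Ak , Bj , inj₁ 1+k<j
    ...   | inj₂ refl  = ⊥-elim (clash lo<j j<hi Ak′ Bj)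
    pick : _
    pick with m≤n⇒m<n∨m≡n lo≤l
    ... | inj₁ lo<l = from lo<l l<hi Bl
    ... | inj₂ refl = from ≤-refl (≤-trans (m≤n+m (2 + lo) 3) long) Bl′
  distant {lo} {hi} long clash {l = l} lo≤k k<hi Ak Ak′ lo≤l l<hi Bl Bl′ | inj₂ refl | _
    with m≤n⇒m<n∨m≡n lo≤l
  ... | inj₂ refl = ⊥-elim (clash ≤-refl 1+lo<hi Ak′ Bl′)
    where 1+lo<hi = ≤-trans (m≤n+m (2 + lo) 3) long
  ... | inj₁ lo<l with m≤n⇒m<n∨m≡n lo<l
  ...   | inj₂ refl = ⊥-elim (clash ≤-refl l<hi Ak′ Bl)
  ...   | inj₁ 1+lo<l with m≤n⇒m<n∨m≡n 1+lo<l
  ...     | inj₁ 2+lo<l = suc lo , l , (≤-refl , <-trans 1+lo<l l<hi) , (lo<l , l<hi) , Ak′ , Bl , inj₁ 2+lo<l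
  ...     | inj₂ refl = suc lo , 3 + lo , (≤-refl , <-trans 1+lo<l l<hi) ,
              (m≤n+m (suc lo) 2 , ≤-trans (m≤n+m (4 + lo) 1) long) , Ak′ , Bl′ , inj₁ ≤-refl
  distant {lo} {hi} long clash {k} {l} lo≤k k<hi Ak Ak′ lo≤l l<hi Bl Bl′ | inj₁ lo<k | inj₂ refl
    with <-cmp (suc l) k
  ... | tri≈ _ refl _ = ⊥-elim (clash lo<k k<hi Ak Bl′)
  ... | tri> _ _ k<1+l = ⊥-elim (clash lo<k k<hi Ak (subst _ (≤-antisym (≤-pred l<hi) (≤-pred k<1+l)) Bl))
  ... | tri< 1+l<k _ _ with m≤n⇒m<n∨m≡n 1+l<k
  ...   | inj₁ 2+l<k = k , suc l , (lo<k , k<hi) , (s≤s lo≤l , <-trans 1+l<k k<hi) , Ak , Bl′ , inj₂ 2+l<k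
  ...   | inj₂ refl = k , l , (lo<k , k<hi) ,
          (≤-trans (n≤1+n (suc lo)) (≤-pred (≤-pred (≤-pred long))) , l<hi) , Ak , Bl , inj₂ ≤-refl

  -- Counting edges complete to `X` without one or both vertices of a pair

  module PairPart {X : List V} (fit : Fit X) (pair : Dual.RemovablePair X) {lo hi : ℕ}
    (P : IsPath p lo hi) (long : 5 + lo ≤ hi)
    (Xlo : Complete X (p lo)) (Xhi : Complete X (p hi))
    (inC : Interior C p lo hi) (none : Interior (¬_ ∘ Complete X) p lo hi)
    (ih : ∀ {T} → (∀ {x} → x ∈ T → x ∈ X) → ConnectedList _≁_ T → length T < length X →
          count (allComplete T) lo hi ≡ true) where
    open Fit fit
    open Dual.RemovablePair pair renaming (x≁y to x~y)

    private
      1+lo<hi : suc lo < hi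
      1+lo<hi = ≤-trans (m≤n+m (2 + lo) 3) long

    smaller : ∀ {x r} → X ↭ x ∷ r → length r < length X
    smaller X↭ = ≤-reflexive (sym (↭-length X↭))

    count-x : count (allComplete l-x) lo hi ≡ true
    count-x = ih (∈-undrop l↭x) connected₁ (smaller l↭x)

    count-y : count (allComplete l-y) lo hi ≡ true
    count-y = ih (∈-undrop l↭y) connected₂ (smaller l↭y)

    both-complete : ∀ {v} → Complete l-x v → Complete l-y v → Complete X v
    both-complete Av Bv {z} z∈X with z ≡? x
    ... | no z≢x   = Av (∈-drop l↭x z∈X z≢x)
    ... | yes refl = Bv (∈-drop l↭y z∈X (~⇒≢ x~y))

    misses-x : ∀ {k} → lo < k → k < hi → Complete l-x (p k) → x ≁ p k
    misses-x l u A = missing fit l↭x (inC l u) A (none l u)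

    misses-y : ∀ {k} → lo < k → k < hi → Complete l-y (p k) → y ≁ p k
    misses-y l u B = missing fit l↭y (inC l u) B (none l u)

    module _ {q m} (Q : Dual.IsPath q 0 m) (q₀ : q 0 ≡ x) (qₘ : q m ≡ y)
      (inX : Interior (_∈ X) q 0 m) where
      open Antihole fit l↭x l↭y Q q₀ qₘ x~y inX

      -- Odd counts are nonzero, so there are edges complete to `l-x` and to `l-y`. Two of their
      -- interior ends that are apart on the path are nonadjacent and close the antipath to an
      -- antihole.
      antipath-odd : parity m ≡ true
      antipath-odd
        with k , lo≤k , k<hi , ek ← count≡true⇒∃ {allComplete l-x} (lo≤hi P) count-x
           | l , lo≤l , l<hi , el ← count≡true⇒∃ {allComplete l-y} (lo≤hi P) count-y
        with Ak , Ak′ ← allComplete⇒Complete l-x ek | Bl , Bl′ ← allComplete⇒Complete l-y el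
        with distant {A = Complete l-x ∘ p} {Complete l-y ∘ p} long
               (λ l u A B → none l u (both-complete A B)) lo≤k k<hi Ak Ak′ lo≤l l<hi Bl Bl′
      ... | i , j , (lo<i , i<hi) , (lo<j , j<hi) , Ai , Bj , far =
        nonadjacent⇒odd (misses-x lo<i i<hi Ai) (misses-y lo<j j<hi Bj) Ai Bj (apart far)
        where
        apart : suc i < j ⊎ suc j < i → p i ≁ p j
        apart (inj₁ 1+i<j) = chord P (<⇒≤ lo<i) 1+i<j (<⇒≤ j<hi)
        apart (inj₂ 1+j<i) = ≁-sym (chord P (<⇒≤ lo<j) 1+j<i (<⇒≤ i<hi))

      -- Every r-complete interior vertex sees exactly one of x and y, and two
      -- adjacent ones see the same one; so an r-complete edge is complete to
      -- exactly one of X ∖ x and X ∖ y.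
      no-common-rest : ∀ {r} → X ↭ x ∷ y ∷ r → ConnectedList _≁_ r → ⊥
      -- The count for `r` is odd by `ih`, yet it is the sum of the odd counts for `l-x` and `l-y`.
      no-common-rest {r} X↭ conn = contradiction
        (≡-trans (sym (ih r⊆X conn (<⇒≤ (smaller′))))
        (≡-trans (count-cong (lo≤hi P) split)
        (≡-trans (count-xor (allComplete l-x) (allComplete l-y) lo hi) (cong₂ _xor_ count-x count-y))))
        λ ()
        where
        smaller′ : suc (length r) < length X
        smaller′ = ≤-reflexive (sym (↭-length X↭))
        r⊆X : ∀ {z} → z ∈ r → z ∈ X
        r⊆X z∈r = ∈-resp-↭ (↭-sym X↭) (there (there z∈r))
        l-x↭ : l-x ↭ y ∷ r
        l-x↭ = drop-∷ (trans (↭-sym l↭x) X↭)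
        l-y↭ : l-y ↭ x ∷ r
        l-y↭ = drop-∷ (trans (↭-sym l↭y) (trans X↭ (swap x y refl)))
        cons-complete : ∀ {l z v} → l ↭ z ∷ r → z ~ v → Complete r v → Complete l v
        cons-complete l↭ z~v rv z′∈l with ∈-resp-↭ l↭ z′∈l
        ... | here refl = z~v
        ... | there z′∈ = rv z′∈
        seen : ∀ {k} → lo < k → k < hi → Complete r (p k) → Complete l-x (p k) ⊎ Complete l-y (p k)
        seen {k} l u rk with x ~? p k | y ~? p k
        ... | yes x~ | _      = inj₂ (cons-complete l-y↭ x~ rk)
        ... | no _   | yes y~ = inj₁ (cons-complete l-x↭ y~ rk)
        -- Missing both `x` and `y`, the vertex `p k` would close the odd antipath to an antihole.
        ... | no ¬x~ | no ¬y~ = contradiction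
          (≡-trans (sym antipath-odd) (missed⇒even
            (¬~⇒≁ (disjoint (∈-head l↭x) (inC l u)) ¬x~) (¬~⇒≁ (disjoint (∈-head l↭y) (inC l u)) ¬y~)
            λ 0<j j<m → rk (∈-drop l-x↭ (in-l-x 0<j (<⇒≤ j<m))
              λ eq → Dual.path-injective Q z≤n j<m ≤-refl (≡-trans eq (sym qₘ)))))
          λ ()
        Same : ℕ → Set
        Same k = Complete l-x (p k) × Complete l-x (p (suc k)) ⊎ Complete l-y (p k) × Complete l-y (p (suc k))
        same : ∀ {k} → lo ≤ k → k < hi → Complete r (p k) → Complete r (p (suc k)) → Same k
        same {k} l u rk rk′ with m≤n⇒m<n∨m≡n l | m≤n⇒m<n∨m≡n u
        ... | inj₂ refl | _ with seen ≤-refl 1+lo<hi rk′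
        ...   | inj₁ A′ = inj₁ ((λ z∈ → Xlo (∈-undrop l↭x z∈)) , A′)
        ...   | inj₂ B′ = inj₂ ((λ z∈ → Xlo (∈-undrop l↭y z∈)) , B′)
        same l u rk rk′ | inj₁ lo<k | inj₂ refl with seen lo<k u rk
        ...   | inj₁ A = inj₁ (A , (λ z∈ → Xhi (∈-undrop l↭x z∈)))
        ...   | inj₂ B = inj₂ (B , (λ z∈ → Xhi (∈-undrop l↭y z∈)))
        same {k} l u rk rk′ | inj₁ lo<k | inj₁ 1+k<hi
          with seen lo<k u rk | seen (m≤n⇒m≤1+n lo<k) 1+k<hi rk′
        ... | inj₁ A | inj₁ A′ = inj₁ (A , A′)
        ... | inj₂ B | inj₂ B′ = inj₂ (B , B′)
        ... | inj₁ A | inj₂ B′ = contradiction (≡-trans (sym antipath-odd)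
          (adjacent⇒even (misses-x lo<k u A) (misses-y (m≤n⇒m≤1+n lo<k) 1+k<hi B′) A B′
            (inC lo<k u) (inC (m≤n⇒m≤1+n lo<k) 1+k<hi) (edge P l u))) λ ()
        ... | inj₂ B | inj₁ A′ = contradiction (≡-trans (sym antipath-odd)
          (adjacent⇒even (misses-x (m≤n⇒m≤1+n lo<k) 1+k<hi A′) (misses-y lo<k u B) A′ B
            (inC (m≤n⇒m≤1+n lo<k) 1+k<hi) (inC lo<k u) (~-sym (edge P l u)))) λ ()
        rest-complete : ∀ {l z k} → l ↭ z ∷ r → allComplete l k ≡ true → allComplete r k ≡ true
        rest-complete {l} l↭ eq with lk , lk′ ← allComplete⇒Complete l eq =
          Complete⇒allComplete r (λ z∈ → lk (∈-undrop l↭ z∈)) (λ z∈ → lk′ (∈-undrop l↭ z∈))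
        split : ∀ k → lo ≤ k → k < hi → allComplete r k ≡ allComplete l-x k xor allComplete l-y k
        split k l u with allComplete l-x k in ex | allComplete l-y k in ey
        ... | true | false = rest-complete l-x↭ ex
        ... | false | true = rest-complete l-y↭ ey
        ... | true | true
          with A , A′ ← allComplete⇒Complete l-x ex | B , B′ ← allComplete⇒Complete l-y ey =
          ⊥-elim (one-is-interior {T = Complete X} 1+lo<hi l u
            (both-complete A B) (both-complete A′ B′) none)
        ... | false | false with allComplete r k in er
        ...   | false = refl
        ...   | true with rk , rk′ ← allComplete⇒Complete r er with same l u rk rk′
        ...     | inj₁ (A , A′) = ≡-trans (sym (Complete⇒allComplete l-x A A′)) ex
        ...     | inj₂ (B , B′) = ≡-trans (sym (Complete⇒allComplete l-y B B′)) ey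

    -- A common nonneighbour of `x` and `y` gives an antipath of length two, against `antipath-odd`.
    -- Otherwise an antipath is taken through the anticonnected rest `r`, and the counts contradict
    -- each other.
    absurd : ⊥
    absurd with both
    ... | inj₁ (w , w∈X , x≁w , w≁y) = contradiction
      (antipath-odd {prepend x (prepend w λ _ → y)} {2}
        (prependPath (prependPath (inducedPath z≤n (λ _ ()) (λ { _ () z≤n })) w≁y λ { () z≤n })
          x≁w λ { {suc zero} _ _ → x~y ; {suc (suc _)} _ (s≤s ()) })
        refl refl λ { {suc zero} _ _ → w∈X ; {suc (suc _)} _ (s≤s (s≤s ())) })
      λ ()
    ... | inj₂ (r , X↭ , conn)
      with w , w∈X , x≁w ← Dual.neighbourInList anticonnected (∈-head l↭x) (∈-head l↭y) (~⇒≢ x~y)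
         | z , z∈X , y≁z ← Dual.neighbourInList anticonnected (∈-head l↭y) (∈-head l↭x) (≢-sym (~⇒≢ x~y))
      with q , m , Q , q₀ , qₘ , inr ← Dual.pathThrough (Dual.walkInList conn)
             (λ y∈r → y∉l-y (∈-undrop (drop-∷ (trans (↭-sym l↭y) (trans X↭ (swap x y refl)))) y∈r))
             (λ x∈r → x∉l-x (∈-undrop (drop-∷ (trans (↭-sym l↭x) X↭)) x∈r))
             (≢-sym (~⇒≢ x~y))
             (∈-drop (drop-∷ (trans (↭-sym l↭x) X↭)) (∈-drop l↭x w∈X (≢-sym (≁⇒≢ x≁w)))
               λ { refl → exclusive x~y x≁w })
             x≁w
             (∈-drop (drop-∷ (trans (↭-sym l↭y) (trans X↭ (swap x y refl))))
               (∈-drop l↭y z∈X (≢-sym (≁⇒≢ y≁z))) λ { refl → exclusive (~-sym x~y) y≁z })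
             y≁z =
      no-common-rest Q q₀ qₘ (λ l u → ∈-resp-↭ (↭-sym X↭) (there (there (inr l u)))) X↭ conn

  -- Induction on a bound `n` for the size of `X`. If the path were odd, then by `countComplete`
  -- every smaller anticonnected subset of `X` would have an odd number of complete edges.
  evenGaps : ∀ n {X} → length X ≤ n → Fit X → EvenGaps X
  evenGaps zero {[]} _ fit with () ← Fit.anticonnected fit
  evenGaps (suc n) {X} bound fit {lo} {hi} P 1+lo<hi Xlo Xhi inC none with parity lo ≟ᵇ parity hi
  ... | inj₁ eq = eq
  ... | inj₂ ne with d , eq ← m≤n⇒∃[o]m+o≡n (<⇒≤ 1+lo<hi) =
    ⊥-elim (distance d (≡-trans (cong suc (+-comm d lo)) eq))
    where
    lo<hi = <⇒≤ 1+lo<hi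
    odd : parity lo xor parity hi ≡ true
    odd = ≡-trans (cong (_xor parity hi) ne) (lemma (parity hi))
      where
      lemma : ∀ a → not a xor a ≡ true
      lemma false = refl
      lemma true  = refl
    ih : ∀ {T} → (∀ {x} → x ∈ T → x ∈ X) → ConnectedList _≁_ T → length T < length X →
      count (allComplete T) lo hi ≡ true
    ih T⊆X conn lt = ≡-trans
      (countComplete (evenGaps n (≤-pred (<-≤-trans lt bound)) (restrict fit T⊆X conn)) P lo<hi
        (Xlo ∘ T⊆X) (Xhi ∘ T⊆X) inC) odd
    long : 5 + lo ≤ hi → ⊥
    long le with Dual.removablePair (Fit.anticonnected fit)
    ... | inj₁ stable = StablePart.absurd fit stable P 1+lo<hi Xlo Xhi inC none
                          (≡-trans (count-true lo hi) odd) ih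
    ... | inj₂ pair = PairPart.absurd fit pair P le Xlo Xhi inC none ih
    -- The path has `suc d` edges. Even lengths contradict `ne`, three edges are treated directly,
    -- and from five edges on `distant` has the room it needs.
    distance : ∀ d → suc d + lo ≡ hi → ⊥
    distance 0 refl = <-irrefl refl 1+lo<hi
    distance 1 refl = ≡-not (≡-trans ne (not-involutive _))
    distance 2 refl = no-three-edge-path fit P Xlo Xhi inC none
    distance 3 refl = ≡-not (≡-trans ne (≡-trans (not-involutive _) (not-involutive _)))
    distance (suc (suc (suc (suc d)))) refl = long (+-monoʳ-≤ 5 (m≤n+m lo d))

-- Skew partitions

record Disconnection {V : Set} (R : Rel V 0ℓ) (A : V → Set) : Set₁ where
  field
    S      : V → Set
    {u w}  : V
    u∈A    : A u
    w∈A    : A w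
    u∈S    : S u
    w∉S    : ¬ S w
    -- A walk inside `A` that starts in `S` stays in `S`, so none leads from `u` to `w`.
    closed : ∀ {x y} → A x → A y → S x → R x y → S y

record BalancedSkew {V} (𝔾 : BergeRelation V) : Set₁ where
  open BergeRelation 𝔾
  field
    A B               : V → Set
    cover             : ∀ v → A v ⊎ B v
    disjoint          : ∀ {v} → A v → B v → ⊥
    disconnection     : Disconnection _~_ A
    antidisconnection : Disconnection _≁_ B
    balanced          : BalancedPair 𝔾 A B

dualSkew : ∀ {V} {𝔾 : BergeRelation V} → BalancedSkew (dual 𝔾) → BalancedSkew 𝔾
dualSkew s = record
  { A = B ; B = A ; cover = λ v → [ inj₂ , inj₁ ]′ (cover v) ; disjoint = flip disjoint
  ; disconnection = antidisconnection ; antidisconnection = disconnection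
  ; balanced = record { no-odd-path = no-odd-antipath ; no-odd-antipath = no-odd-path } }
  where
  open BalancedSkew s
  open BalancedPair balanced

-- A skew partition A₁ ∪ A₂, B₁ ∪ B₂ in which a vertex of A₁ is complete to B₁.
record LooseSkew {V} (𝔾 : BergeRelation V) : Set where
  open BergeRelation 𝔾
  field
    A₁ A₂ B₁ B₂    : List V
    cover          : ∀ v → (v ∈ A₁ ⊎ v ∈ A₂) ⊎ (v ∈ B₁ ⊎ v ∈ B₂)
    disjoint       : ∀ {v} → v ∈ A₁ ⊎ v ∈ A₂ → v ∈ B₁ ⊎ v ∈ B₂ → ⊥
    anticomplete   : ∀ {x y} → x ∈ A₁ → y ∈ A₂ → x ≁ y
    complete       : ∀ {x y} → x ∈ B₁ → y ∈ B₂ → x ~ y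
    connected₂     : ConnectedList _~_ A₂
    anticonnected₁ : ConnectedList _≁_ B₁
    {a b₂}         : V
    a∈A₁           : a ∈ A₁
    a-complete     : ∀ {b} → b ∈ B₁ → a ~ b
    b₂∈B₂          : b₂ ∈ B₂

-- Balancing a loose skew partition

∃-member : ∀ {V : Set} {R : Rel V 0ℓ} {l} → ConnectedList R l → ∃[ x ] x ∈ l
∃-member (single x)       = x , here refl
∃-member (attach _ _ _ _) = _ , here refl

module Balancing {V} (𝔾 : BergeRelation V) (cfg : LooseSkew 𝔾) where
  open BergeRelation 𝔾
  open Paths 𝔾
  open LooseSkew cfg
  private module Dual = Paths (dual 𝔾)

  InA : V → Set
  InA v = v ∈ A₁ ⊎ v ∈ A₂

  -- The vertex a closes every path or antipath between A₂ and B₁ to a hole or antihole.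
  balanced₂₁ : BalancedPair 𝔾 (_∈ A₂) (_∈ B₁)
  balanced₂₁ = record
    { no-odd-path = λ P l h ends int → holes-even P (nonadjacent-ends P ends)
        (a-complete l) (a-complete h) λ l u → anticomplete a∈A₁ (int l u)
    ; no-odd-antipath = λ P l h ends int → antiholes-even P (Dual.nonadjacent-ends P ends)
        (anticomplete a∈A₁ l) (anticomplete a∈A₁ h) λ l u → a-complete (int l u) }

  Attached : Set
  Attached = (∃[ b ] (∀ {x} → x ∈ B₁ → x ≡ b)) ⊎ (∀ {b} → b ∈ B₁ → ∃[ w ] w ∈ A₂ × b ~ w)

  module _ (attached : Attached) where

    -- A path through `A₁` forms a hole with a path through `A₂` between the same ends, which is
    -- even by `balanced₂₁`. For an antipath between vertices of `A₁`, the set `A₂` is anticomplete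
    -- to both ends but to no interior vertex, so the Roussel-Rubio lemma applies to `A₂` in the
    -- complement. If `B₁` is a single vertex, both claims are immediate.
    balanced₁ : BalancedPair 𝔾 InA (_∈ B₁)
    balanced₁ = record { no-odd-path = paths ; no-odd-antipath = antipaths }
      where
      open BalancedPair balanced₂₁
      paths : NoOddPath InA (_∈ B₁)
      paths {p} {lo} {hi} P l h ends inA
        with path-in-one-side anticomplete P (nonadjacent-ends P ends) inA
      ... | inj₂ in₂ = no-odd-path P l h ends in₂
      ... | inj₁ in₁ = through-A₁ attached
        where
        through-A₁ : Attached → parity lo ≡ parity hi
        through-A₁ (inj₁ (b , ≡b)) = contradiction (≡-trans (≡b l) (sym (≡b h))) (≁⇒≢ ends)
        through-A₁ (inj₂ neighbour) =
          parity-via P ends in₁ anticomplete connected₂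
            (λ ∈A₂ → disjoint (inj₂ ∈A₂) (inj₁ l)) (λ ∈A₂ → disjoint (inj₂ ∈A₂) (inj₁ h))
            (neighbour l) (neighbour h)
            λ Q q₀ qₘ in₂ → sym (no-odd-path Q (subst (_∈ B₁) (sym q₀) h) (subst (_∈ B₁) (sym qₘ) l)
              (subst₂ _≁_ (sym q₀) (sym qₘ) (≁-sym ends)) in₂)
      antipaths : Dual.NoOddPath (_∈ B₁) InA
      antipaths P (inj₁ l) (inj₂ h) ends _ = ⊥-elim (exclusive ends (anticomplete l h))
      antipaths P (inj₂ l) (inj₁ h) ends _ = ⊥-elim (exclusive (~-sym ends) (anticomplete h l))
      antipaths P (inj₂ l) (inj₂ h) ends int = no-odd-antipath P l h ends int
      antipaths {p} {lo} {hi} P (inj₁ l) (inj₁ h) ends int = in-A₁ attached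
        where
        in-A₁ : Attached → parity lo ≡ parity hi
        in-A₁ (inj₁ (b , ≡b))  = Dual.constant-interior P ends λ l u → ≡b (int l u)
        in-A₁ (inj₂ neighbour) = RousselRubio.evenGaps (dual 𝔾) p (_∈ B₁) (length A₂) ≤-refl
          record { anticonnected = connected₂
                 ; disjoint = λ { x∈A₂ c∈B₁ refl → disjoint (inj₂ x∈A₂) (inj₁ c∈B₁) }
                 ; balanced = dualBalanced balanced₂₁ }
          P (Dual.nonadjacent-ends P ends)
          (λ x∈A₂ → ≁-sym (anticomplete l x∈A₂)) (λ x∈A₂ → ≁-sym (anticomplete h x∈A₂)) int
          λ l u none → let (w , w∈A₂ , b~w) = neighbour (int l u) in exclusive (~-sym b~w) (none w∈A₂)

    -- If L has only B₁-complete vertices, one of them is kept: an odd path with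
    -- nonadjacent ends cannot have a single interior vertex.
    record Kept (L : List V) : Set₁ where
      field
        R         : V → Set
        R?        : ∀ v → Dec (R v)
        R⊆L       : ∀ {v} → R v → v ∈ L
        inhabited : ∃[ v ] R v
        keeps     : ∀ {v} → v ∈ L → ¬ Complete B₁ v → R v
        kind      : (∀ {v} → R v → ¬ Complete B₁ v) ⊎ (∀ {v w} → R v → R w → v ≡ w)

    keep : ∀ {L v} → v ∈ L → Kept L
    keep {L} {v} v∈L with search L (λ {z} _ → dec z)
      where
      dec : ∀ z → Complete B₁ z ⊎ ¬ Complete B₁ z
      dec z with complete? B₁ z
      ... | yes c = inj₁ c
      ... | no ¬c = inj₂ ¬c
    ... | inj₁ all = record
      { R = _≡ v ; R? = _≡? v ; R⊆L = λ { refl → v∈L } ; inhabited = v , refl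
      ; keeps = λ z∈L ¬c → contradiction (λ {x} → all z∈L {x}) ¬c
      ; kind = inj₂ λ { refl refl → refl } }
    ... | inj₂ (z , z∈L , ¬c) = record
      { R = λ z → z ∈ L × ¬ Complete B₁ z ; R? = λ z → (z ∈? L) ×-dec ¬? (complete? B₁ z)
      ; R⊆L = proj₁ ; inhabited = z , z∈L , ¬c ; keeps = _,_ ; kind = inj₁ proj₂ }

    private
      module K₁ = Kept (keep a∈A₁)
      module K₂ = Kept (keep (proj₂ (∃-member connected₂)))

    A′ B′ : V → Set
    A′ v = K₁.R v ⊎ K₂.R v
    B′ v = ¬ A′ v

    A′⊆A : ∀ {v} → A′ v → InA v
    A′⊆A = [ inj₁ ∘ K₁.R⊆L , inj₂ ∘ K₂.R⊆L ]′

    apart′ : ∀ {x y} → K₁.R x → K₂.R y → x ≁ y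
    apart′ r₁ r₂ = anticomplete (K₁.R⊆L r₁) (K₂.R⊆L r₂)

    B′-cases : ∀ {v} → B′ v → v ∈ B₁ ⊎ Complete B₁ v
    B′-cases {v} ¬A′v with complete? B₁ v | cover v
    ... | yes c | _                  = inj₂ c
    ... | no ¬c | inj₁ (inj₁ v∈A₁) = contradiction (inj₁ (K₁.keeps v∈A₁ ¬c)) ¬A′v
    ... | no ¬c | inj₁ (inj₂ v∈A₂) = contradiction (inj₂ (K₂.keeps v∈A₂ ¬c)) ¬A′v
    ... | no ¬c | inj₂ (inj₁ v∈B₁) = inj₁ v∈B₁
    ... | no ¬c | inj₂ (inj₂ v∈B₂) = contradiction (λ {x} x∈B₁ → complete {x} x∈B₁ v∈B₂) ¬c

    -- Vertices of `B′` outside `B₁` are `B₁`-complete, so nonadjacent ends are both in `B₁` or both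
    -- `B₁`-complete. In the latter case the interior lies on one side of `A′`, which is a single
    -- vertex or has no `B₁`-complete vertices; then `evenGaps` applies to `B₁`.
    paths : NoOddPath A′ B′
    paths {p} {lo} {hi} P l h ends inA′ = by-cases (B′-cases l) (B′-cases h)
      where
      1+lo<hi = nonadjacent-ends P ends
      within : Complete B₁ (p lo) → Complete B₁ (p hi) → ∀ {R : V → Set} → Interior R p lo hi →
        (∀ {v} → R v → ¬ Complete B₁ v) ⊎ (∀ {v w} → R v → R w → v ≡ w) → parity lo ≡ parity hi
      within _ _ inR (inj₂ unique) = constant-interior P ends λ l u →
        unique (inR l u) (inR ≤-refl 1+lo<hi)
      within lc hc inR (inj₁ incomplete) = RousselRubio.evenGaps 𝔾 p InA (length B₁) ≤-refl
        record { anticonnected = anticonnected₁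
               ; disjoint = λ { x∈B₁ c∈A refl → disjoint c∈A (inj₁ x∈B₁) } ; balanced = balanced₁ }
        P 1+lo<hi lc hc (λ l u → A′⊆A (inA′ l u)) λ l u → incomplete (inR l u)
      by-cases : p lo ∈ B₁ ⊎ Complete B₁ (p lo) → p hi ∈ B₁ ⊎ Complete B₁ (p hi) → parity lo ≡ parity hi
      by-cases (inj₁ l∈) (inj₁ h∈) =
        BalancedPair.no-odd-path balanced₁ P l∈ h∈ ends λ l u → A′⊆A (inA′ l u)
      by-cases (inj₁ l∈) (inj₂ hc) = ⊥-elim (exclusive (hc l∈) ends)
      by-cases (inj₂ lc) (inj₁ h∈) = ⊥-elim (exclusive (lc h∈) (≁-sym ends))
      by-cases (inj₂ lc) (inj₂ hc) with path-in-one-side apart′ P 1+lo<hi inA′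
      ... | inj₁ in₁ = within lc hc in₁ K₁.kind
      ... | inj₂ in₂ = within lc hc in₂ K₂.kind

    -- In the complement there are no edges between `B₁` and the `B₁`-complete vertices, so the
    -- interior lies among one of these kinds. In the second case the adjacent ends are on the same
    -- side of `A′` and have nonneighbours in `B₁`. An antipath through `B₁` between them is even by
    -- `balanced₁` and completes an antihole.
    antipaths : Dual.NoOddPath B′ A′
    antipaths {p} {lo} {hi} P l h ends inB′
      with Dual.path-in-one-side {_∈ B₁} {Complete B₁} (λ x∈B₁ yc → yc x∈B₁) P (Dual.nonadjacent-ends P ends)
             (λ l u → B′-cases (inB′ l u))
    ... | inj₁ in₁ = BalancedPair.no-odd-antipath balanced₁ P (A′⊆A l) (A′⊆A h) ends in₁
    ... | inj₂ inC = same-side l h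
      where
      outside : ∀ {v} → A′ v → v ∉ B₁
      outside v∈A′ v∈B₁ = disjoint (A′⊆A v∈A′) (inj₁ v∈B₁)
      nonneighbour : ∀ {v} → v ∉ B₁ → ¬ Complete B₁ v → ∃[ b ] b ∈ B₁ × v ≁ b
      nonneighbour {v} v∉B₁ ¬c with search B₁ (λ {x} x∈B₁ → ≢⇒~⊎≁ {x} {v} λ { refl → v∉B₁ x∈B₁ })
      ... | inj₁ all             = contradiction (λ {x} → all {x}) ¬c
      ... | inj₂ (b , b∈B₁ , b≁v) = b , b∈B₁ , ≁-sym b≁v
      within : ∀ {R : V → Set} → R (p lo) → R (p hi) →
        (∀ {v} → R v → ¬ Complete B₁ v) ⊎ (∀ {v w} → R v → R w → v ≡ w) → parity lo ≡ parity hi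
      within Rl Rh (inj₂ unique) = contradiction (unique Rl Rh) (~⇒≢ ends)
      within Rl Rh (inj₁ incomplete) = Dual.parity-via {T = Complete B₁} P ends inC
        (λ xc y∈B₁ → ~-sym (xc y∈B₁))
        anticonnected₁ (outside l) (outside h)
        (nonneighbour (outside l) (incomplete Rl)) (nonneighbour (outside h) (incomplete Rh))
        λ Q q₀ qₘ in₁ → sym (BalancedPair.no-odd-antipath balanced₁ Q
          (subst InA (sym q₀) (A′⊆A h)) (subst InA (sym qₘ) (A′⊆A l))
          (subst₂ _~_ (sym q₀) (sym qₘ) (~-sym ends)) in₁)
      same-side : A′ (p lo) → A′ (p hi) → parity lo ≡ parity hi
      same-side (inj₁ l) (inj₁ h) = within l h K₁.kind
      same-side (inj₂ l) (inj₂ h) = within l h K₂.kind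
      same-side (inj₁ l) (inj₂ h) = ⊥-elim (exclusive ends (apart′ l h))
      same-side (inj₂ l) (inj₁ h) = ⊥-elim (exclusive (~-sym ends) (apart′ h l))

    balancedSkew : BalancedSkew 𝔾
    balancedSkew = record
      { A = A′ ; B = B′ ; cover = decide ; disjoint = λ a b → b a
      ; disconnection = record
        { S = K₁.R
        ; u∈A = inj₁ (proj₂ K₁.inhabited) ; w∈A = inj₂ (proj₂ K₂.inhabited)
        ; u∈S = proj₂ K₁.inhabited ; w∉S = λ r₁ → ≁-irrefl (apart′ r₁ (proj₂ K₂.inhabited))
        ; closed = λ { _ (inj₁ r₁) _ _ → r₁ ; _ (inj₂ r₂) r₁ x~y → ⊥-elim (exclusive x~y (apart′ r₁ r₂)) } }
      ; antidisconnection = record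
        { S = _∈ B₁
        ; u∈A = λ a∈ → disjoint (A′⊆A a∈) (inj₁ (proj₂ (∃-member anticonnected₁)))
        ; w∈A = λ a∈ → disjoint (A′⊆A a∈) (inj₂ b₂∈B₂)
        ; u∈S = proj₂ (∃-member anticonnected₁) ; w∉S = λ b₂∈B₁ → ~-irrefl (complete b₂∈B₁ b₂∈B₂)
        ; closed = λ _ y∈B′ x∈B₁ x≁y → [ id , (λ yc → ⊥-elim (exclusive (yc x∈B₁) x≁y)) ]′ (B′-cases y∈B′) }
      ; balanced = record { no-odd-path = paths ; no-odd-antipath = antipaths } }
      where
      decide : ∀ v → A′ v ⊎ B′ v
      decide v with K₁.R? v ⊎-dec K₂.R? v
      ... | yes a = inj₁ a
      ... | no ¬a = inj₂ ¬a

-- While B₁ is not a single vertex, a vertex of B₁ without neighbours in A₂ can be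
-- moved to A₁, and B₁ be replaced by an anticomponent of what remains of it.
balance : ∀ {V} (𝔾 : BergeRelation V) n (cfg : LooseSkew 𝔾) → length (LooseSkew.B₁ cfg) ≤ n → BalancedSkew 𝔾
balance {V} 𝔾 n cfg bound = attach-or-move n bound (search B₁ attached?)
  where
  open BergeRelation 𝔾
  open Paths 𝔾
  open LooseSkew cfg
  module Dual = Paths (dual 𝔾)
  attached? : ∀ {x} → x ∈ B₁ → (∃[ w ] w ∈ A₂ × x ~ w) ⊎ (∀ {w} → w ∈ A₂ → w ≁ x)
  attached? {x} x∈B₁ with search {P = _≁ x} {Q = x ~_} A₂
      (λ w∈A₂ → [ inj₂ ∘ ~-sym , inj₁ ]′ (≢⇒~⊎≁ λ { refl → disjoint (inj₂ w∈A₂) (inj₁ x∈B₁) }))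
  ... | inj₁ none      = inj₂ none
  ... | inj₂ neighbour = inj₁ neighbour
  attach-or-move : ∀ n → length B₁ ≤ n →
    (∀ {x} → x ∈ B₁ → ∃[ w ] w ∈ A₂ × x ~ w) ⊎ (∃[ x ] x ∈ B₁ × (∀ {w} → w ∈ A₂ → w ≁ x)) → BalancedSkew 𝔾
  attach-or-move n _ (inj₁ neighbour) = Balancing.balancedSkew 𝔾 cfg (inj₂ neighbour)
  attach-or-move zero bound (inj₂ (x , x∈B₁ , none)) =
    contradiction (<-≤-trans (length-without x∈B₁) bound) λ ()
  attach-or-move (suc n) bound (inj₂ (x , x∈B₁ , none)) with without x B₁ in eq
  ... | [] = Balancing.balancedSkew 𝔾 cfg (inj₁ (x , only))
    where
    only : ∀ {z} → z ∈ B₁ → z ≡ x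
    only {z} z∈B₁ with z ≡? x
    ... | yes z≡x = z≡x
    ... | no z≢x with () ← subst (z ∈_) eq (∈-without⁺ z∈B₁ z≢x)
  ... | y ∷ L = balance 𝔾 n moved
      (≤-trans size (≤-pred (≤-trans
        (subst (λ l → suc (length l) ≤ length B₁) eq (length-without x∈B₁)) bound)))
    where
    -- `K` is the anticomponent of `y` in `B₁` without `x`. The remainder `R` is complete to `K` and
    -- joins `B₂`.
    open Dual.Component (Dual.component (length L) {y ∷ []} {L} ≤-refl (single y))
      renaming (connected to anticonnected)
    remaining : ∀ {z} → z ∈ y ∷ [] ⊎ z ∈ L → z ∈ B₁ × z ≢ x
    remaining (inj₁ (here refl)) = ∈-without⁻ (subst (_ ∈_) (sym eq) (here refl))
    remaining (inj₂ z∈L)         = ∈-without⁻ (subst (_ ∈_) (sym eq) (there z∈L))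
    K⊆B₁ : ∀ {z} → z ∈ K → z ∈ B₁ × z ≢ x
    K⊆B₁ = remaining ∘ K⊆
    R⊆B₁ : ∀ {z} → z ∈ R → z ∈ B₁ × z ≢ x
    R⊆B₁ = remaining ∘ inj₂ ∘ R⊆
    split : ∀ {z} → z ∈ y ∷ L → z ∈ K ⊎ z ∈ R
    split (here refl) = inj₁ (extends (here refl))
    split (there z∈L) = covers z∈L
    cover′ : ∀ v → (v ∈ x ∷ A₁ ⊎ v ∈ A₂) ⊎ (v ∈ K ⊎ v ∈ R ++ B₂)
    cover′ v with cover v | v ≡? x
    ... | _                  | yes v≡x = inj₁ (inj₁ (here v≡x))
    ... | inj₁ (inj₁ v∈A₁) | _       = inj₁ (inj₁ (there v∈A₁))
    ... | inj₁ (inj₂ v∈A₂) | _       = inj₁ (inj₂ v∈A₂)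
    ... | inj₂ (inj₂ v∈B₂) | _       = inj₂ (inj₂ (∈-++⁺ʳ R v∈B₂))
    ... | inj₂ (inj₁ v∈B₁) | no v≢x  =
      inj₂ ([ inj₁ , inj₂ ∘ ∈-++⁺ˡ ]′ (split (subst (v ∈_) eq (∈-without⁺ v∈B₁ v≢x))))
    old-B : ∀ {v} → v ∈ K ⊎ v ∈ R ++ B₂ → (v ∈ B₁ × v ≢ x) ⊎ v ∈ B₂
    old-B (inj₁ v∈K) = inj₁ (K⊆B₁ v∈K)
    old-B (inj₂ v∈)  = [ inj₁ ∘ R⊆B₁ , inj₂ ]′ (∈-++⁻ R v∈)
    disjoint′ : ∀ {v} → v ∈ x ∷ A₁ ⊎ v ∈ A₂ → v ∈ K ⊎ v ∈ R ++ B₂ → ⊥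
    disjoint′ (inj₁ (here refl)) b with old-B b
    ... | inj₁ (_ , v≢x) = v≢x refl
    ... | inj₂ v∈B₂      = ~-irrefl (complete x∈B₁ v∈B₂)
    disjoint′ (inj₁ (there v∈A₁)) b = disjoint (inj₁ v∈A₁) ([ inj₁ ∘ proj₁ , inj₂ ]′ (old-B b))
    disjoint′ (inj₂ v∈A₂)         b = disjoint (inj₂ v∈A₂) ([ inj₁ ∘ proj₁ , inj₂ ]′ (old-B b))
    moved : LooseSkew 𝔾
    moved = record
      { A₁ = x ∷ A₁ ; A₂ = A₂ ; B₁ = K ; B₂ = R ++ B₂
      ; cover = cover′ ; disjoint = disjoint′
      ; anticomplete = λ { (here refl) y∈A₂ → ≁-sym (none y∈A₂) ; (there x∈A₁) y∈A₂ → anticomplete x∈A₁ y∈A₂ }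
      ; complete = λ x∈K y∈ → [ apart x∈K , complete (proj₁ (K⊆B₁ x∈K)) ]′ (∈-++⁻ R y∈)
      ; connected₂ = connected₂ ; anticonnected₁ = anticonnected
      ; a∈A₁ = there a∈A₁ ; a-complete = λ b∈K → a-complete (proj₁ (K⊆B₁ b∈K))
      ; b₂∈B₂ = ∈-++⁺ʳ R b₂∈B₂ }

-- By `closed`, the set `C` contains the whole anticomponent of `b`, which becomes `B₁`; so `a` is
-- complete to it. The component of `a` goes into `A₁`. A component of the remaining part of `A`
-- becomes `A₂`, and whatever is left joins `A₁`.
looseSkew : ∀ {V} (𝔾 : BergeRelation V) → let open BergeRelation 𝔾 in
  ∀ {A B : List V} {C : V → Set} {a b} → (∀ v → v ∈ A ⊎ v ∈ B) → (∀ {v} → v ∈ A → v ∈ B → ⊥) →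
  (∀ {K} → ConnectedList _~_ K → (∀ {z} → z ∈ K → z ∈ A) → ¬ (∀ {z} → z ∈ A → z ∈ K)) →
  (∀ {K} → ConnectedList _≁_ K → (∀ {z} → z ∈ K → z ∈ B) → ¬ (∀ {z} → z ∈ B → z ∈ K)) →
  a ∈ A → b ∈ B → C b → (∀ {x y} → C x → y ∈ B → x ≁ y → C y) → (∀ {x} → C x → a ~ x) →
  LooseSkew 𝔾
looseSkew {V} 𝔾 {A} {B} {C} {a} {b} cover disjoint ¬conn ¬anticonn a∈A b∈B Cb closed a~C
  with Paths.component 𝔾 (length A) {a ∷ []} {A} ≤-refl (single a)
     | Paths.component (dual 𝔾) (length B) {b ∷ []} {B} ≤-refl (single b)
... | record { K = K ; R = [] ; connected = conn ; K⊆ = K⊆ ; covers = covers } | _ =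
  ⊥-elim (¬conn conn (λ z∈K → [ (λ { (here refl) → a∈A }) , id ]′ (K⊆ z∈K))
    λ z∈A → [ id , (λ ()) ]′ (covers z∈A))
... | _ | record { K = K ; R = [] ; connected = conn ; K⊆ = K⊆ ; covers = covers } =
  ⊥-elim (¬anticonn conn (λ z∈K → [ (λ { (here refl) → b∈B }) , id ]′ (K⊆ z∈K))
    λ z∈B → [ id , (λ ()) ]′ (covers z∈B))
... | record { K = K ; R = u ∷ R ; apart = apart ; extends = extends ; K⊆ = K⊆ ; R⊆ = R⊆ ; covers = covers }
    | record { K = K′ ; R = b₂ ∷ R′ ; connected = anticonn ; apart = apart′ ; extends = extends′
             ; K⊆ = K′⊆ ; R⊆ = R′⊆ ; covers = covers′ } = record
  { A₁ = K ++ R₁ ; A₂ = K₁ ; B₁ = K′ ; B₂ = b₂ ∷ R′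
  ; cover = λ v → [ inj₁ ∘ split , inj₂ ∘ covers′ ]′ (cover v)
  ; disjoint = λ v∈A v∈B → disjoint (in-A v∈A) (in-B v∈B)
  ; anticomplete = λ x∈ y∈K₁ → [ (λ x∈K → apart x∈K (in-R (K₁⊆ y∈K₁)))
                               , (λ x∈R₁ → ≁-sym (apart₁ y∈K₁ x∈R₁)) ]′ (∈-++⁻ K x∈)
  ; complete = apart′
  ; connected₂ = conn₁ ; anticonnected₁ = anticonn
  ; a∈A₁ = ∈-++⁺ˡ (extends (here refl))
  ; a-complete = λ {z} z∈K′ → a~C (along (Paths.walkInList (dual 𝔾) anticonn (extends′ (here refl)) z∈K′) Cb)
  ; b₂∈B₂ = here refl }
  where
  open BergeRelation 𝔾
  open Paths.Component (Paths.component 𝔾 (length R) {u ∷ []} {R} ≤-refl (single u))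
    renaming (K to K₁; R to R₁; connected to conn₁; apart to apart₁; extends to extends₁
             ; K⊆ to K₁⊆; R⊆ to R₁⊆; covers to covers₁)
  in-R : ∀ {z} → z ∈ u ∷ [] ⊎ z ∈ R → z ∈ u ∷ R
  in-R (inj₁ (here refl)) = here refl
  in-R (inj₂ z∈R)         = there z∈R
  split : ∀ {v} → v ∈ A → v ∈ K ++ R₁ ⊎ v ∈ K₁
  split v∈A with covers v∈A
  ... | inj₁ v∈K         = inj₁ (∈-++⁺ˡ v∈K)
  ... | inj₂ (here refl) = inj₂ (extends₁ (here refl))
  ... | inj₂ (there v∈R) = [ inj₂ , inj₁ ∘ ∈-++⁺ʳ K ]′ (covers₁ v∈R)
  in-A : ∀ {v} → v ∈ K ++ R₁ ⊎ v ∈ K₁ → v ∈ A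
  in-A (inj₂ v∈K₁) = R⊆ (in-R (K₁⊆ v∈K₁))
  in-A (inj₁ v∈) with ∈-++⁻ K v∈
  ... | inj₁ v∈K  = [ (λ { (here refl) → a∈A }) , id ]′ (K⊆ v∈K)
  ... | inj₂ v∈R₁ = R⊆ (there (R₁⊆ v∈R₁))
  in-K′ : ∀ {v} → v ∈ K′ → v ∈ B
  in-K′ v∈K′ = [ (λ { (here refl) → b∈B }) , id ]′ (K′⊆ v∈K′)
  in-B : ∀ {v} → v ∈ K′ ⊎ v ∈ b₂ ∷ R′ → v ∈ B
  in-B = [ in-K′ , R′⊆ ]′
  along : ∀ {x y} → Star (Step _≁_ (_∈ K′)) x y → C x → C y
  along ε Cx = Cx
  along ((_ , y∈K′ , x≁y) ◅ w) Cx = along w (closed Cx (in-K′ y∈K′) x≁y)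

-- Translation between graphs on `Fin n` and relations

even⇒parity : ∀ {k} → Even k → parity k ≡ false
even⇒parity (divides q refl) = double q
  where
  double : ∀ q → parity (q * 2) ≡ false
  double zero    = refl
  double (suc q) = ≡-trans (not-involutive _) (double q)

parity⇒even : ∀ k → parity k ≡ false → Even k
parity⇒even zero          _  = divides 0 refl
parity⇒even (suc (suc k)) eq with divides q k≡ ← parity⇒even k (≡-trans (sym (not-involutive _)) eq) =
  divides (suc q) (cong (2 +_) k≡)

clamp : ∀ k → ℕ → Fin (suc k)
clamp zero    _       = zero
clamp (suc k) zero    = zero
clamp (suc k) (suc i) = suc (clamp k i)

toℕ-clamp : ∀ {k i} → i ≤ k → toℕ (clamp k i) ≡ i
toℕ-clamp {zero}  z≤n     = refl
toℕ-clamp {suc k} z≤n     = refl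
toℕ-clamp {suc k} (s≤s u) = cong suc (toℕ-clamp u)

clamp-zero : ∀ k → clamp k 0 ≡ zero
clamp-zero zero    = refl
clamp-zero (suc k) = refl

clamp-self : ∀ k → clamp k k ≡ fromℕ k
clamp-self zero    = refl
clamp-self (suc k) = cong suc (clamp-self k)

-- `S` is nonadjacency in an unspecified form: for the complement it is instantiated with the
-- adjacency of the original graph, which avoids a double complement.
module Translate {n} (G : Graph n) (S : Rel (Fin n) 0ℓ)
  (S⇒ : ∀ {u v} → S u v → u ≢ v × ¬ Graph._~_ G u v)
  (⇒S : ∀ {u v} → u ≢ v → ¬ Graph._~_ G u v → S u v) where
  open Graph G

  -- Each pair is classified only once, for `i < j`; the closing edge of the cycle then joins 0 to
  -- `suc d`.
  cycleHole : ∀ {c : ℕ → Fin n} {d} → 2 ≤ d →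
    (∀ {i j} → i < j → j ≤ suc d →
      ((suc i ≡ j ⊎ (i ≡ 0 × j ≡ suc d)) × c i ~ c j) ⊎
      (¬ (suc i ≡ j ⊎ (i ≡ 0 × j ≡ suc d)) × S (c i) (c j))) →
    Hole G (suc (suc d))
  cycleHole {c} {d} 2≤d pairs = record
    { 4≤length = s≤s (s≤s 2≤d) ; vertex = c ∘ toℕ
    ; injective = λ {i} {j} → injective i j
    ; adjacent = λ i j → mk⇔ (to i j) (from i j) }
    where
    m = suc (suc d)
    bound : ∀ (i : Fin m) → toℕ i ≤ suc d
    bound i = ≤-pred (Fin.toℕ<n i)
    distinct : ∀ {i j} → i < j → j ≤ suc d → c i ≢ c j
    distinct i<j u with pairs i<j u
    ... | inj₁ (_ , e) = λ eq → ~-irrefl eq e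
    ... | inj₂ (_ , s) = proj₁ (S⇒ s)
    injective : ∀ (i j : Fin m) → c (toℕ i) ≡ c (toℕ j) → i ≡ j
    injective i j eq with <-cmp (toℕ i) (toℕ j)
    ... | tri< i<j _ _ = contradiction eq (distinct i<j (bound j))
    ... | tri≈ _ i≡j _ = Fin.toℕ-injective i≡j
    ... | tri> _ _ j<i = contradiction (sym eq) (distinct j<i (bound i))
    orient : ∀ {i j : Fin m} → suc (toℕ i) ≡ toℕ j ⊎ (toℕ i ≡ 0 × toℕ j ≡ suc d) → CycleAdjacent i j
    orient (inj₁ e)         = fwd (inj₁ e)
    orient (inj₂ (e₀ , e₁)) = bwd (inj₂ (cong suc e₁ , e₀))
    to : ∀ (i j : Fin m) → c (toℕ i) ~ c (toℕ j) → CycleAdjacent i j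
    to i j e with <-cmp (toℕ i) (toℕ j)
    ... | tri≈ _ i≡j _ = contradiction e (~-irrefl (cong c i≡j))
    ... | tri< i<j _ _ with pairs i<j (bound j)
    ...   | inj₁ (adj , _) = orient adj
    ...   | inj₂ (_ , s)   = contradiction e (proj₂ (S⇒ s))
    to i j e | tri> _ _ j<i with pairs j<i (bound i)
    ...   | inj₁ (adj , _) = symmetric _ (orient adj)
    ...   | inj₂ (_ , s)   = contradiction (~-sym e) (proj₂ (S⇒ s))
    forced : ∀ {i j} → i < j → j ≤ suc d → suc i ≡ j ⊎ (i ≡ 0 × j ≡ suc d) → c i ~ c j
    forced i<j u adj with pairs i<j u
    ... | inj₁ (_ , e)  = e
    ... | inj₂ (¬a , _) = contradiction adj ¬a
    from₁ : ∀ (i j : Fin m) → suc (toℕ i) ≡ toℕ j ⊎ (suc (toℕ i) ≡ m × toℕ j ≡ 0) → c (toℕ i) ~ c (toℕ j)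
    from₁ i j (inj₁ e) = forced (≤-reflexive e) (bound j) (inj₁ e)
    from₁ i j (inj₂ (e₁ , e₀)) = ~-sym (forced
      (subst₂ _<_ (sym e₀) (sym (suc-injective e₁)) (s≤s z≤n)) (bound i) (inj₂ (e₀ , suc-injective e₁)))
    from : ∀ (i j : Fin m) → CycleAdjacent i j → c (toℕ i) ~ c (toℕ j)
    from i j (fwd adj) = from₁ i j adj
    from i j (bwd adj) = ~-sym (from₁ j i adj)

  -- A path with `d` edges and the further vertex `x` form a hole on `d + 2` vertices.
  holesEven : (∀ {m} → Hole G m → Even m) → HolesEven _~_ S
  holesEven even {p} {lo} {hi} {x} P 1+lo<hi x~lo x~hi Sx
    with d , refl ← m≤n⇒∃[o]m+o≡n (lo≤hi P) = sym (≡-trans (parity-+ lo d)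
      (≡-trans (cong (parity lo xor_) (≡-trans (sym (not-involutive _)) (even⇒parity (even hole))))
        (xor-identityʳ (parity lo))))
    where
    2≤d : 2 ≤ d
    2≤d = +-cancelˡ-≤ lo 2 d (subst (_≤ lo + d) (+-comm 2 lo) 1+lo<hi)
    q : ℕ → Fin n
    q k = p (lo + k)
    hole : Hole G (suc (suc d))
    hole = cycleHole {prepend x q} 2≤d pairs
      where
      pairs : ∀ {i j} → i < j → j ≤ suc d →
        ((suc i ≡ j ⊎ (i ≡ 0 × j ≡ suc d)) × prepend x q i ~ prepend x q j) ⊎
        (¬ (suc i ≡ j ⊎ (i ≡ 0 × j ≡ suc d)) × S (prepend x q i) (prepend x q j))
      pairs {zero} {suc zero} _ _ = inj₁ (inj₁ refl , subst (λ k → x ~ p k) (sym (+-identityʳ lo)) x~lo)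
      pairs {zero} {suc (suc j)} _ (s≤s u) with m≤n⇒m<n∨m≡n u
      ... | inj₂ refl = inj₁ (inj₂ (refl , refl) , x~hi)
      ... | inj₁ j<d = inj₂ ((λ { (inj₁ ()) ; (inj₂ (_ , refl)) → <-irrefl refl j<d }) ,
              Sx (m<m+n lo (s≤s z≤n)) (+-monoʳ-< lo j<d))
      pairs {suc i} {suc j} (s≤s i<j) (s≤s u) with m≤n⇒m<n∨m≡n i<j
      ... | inj₂ refl = inj₁ (inj₁ refl , subst (λ k → p (lo + i) ~ p k) (sym (+-suc lo i))
              (edge P (m≤m+n lo i) (+-monoʳ-< lo u)))
      ... | inj₁ 1+i<j = inj₂ ((λ { (inj₁ refl) → <-irrefl refl 1+i<j ; (inj₂ (() , _)) }) ,
              chord P (m≤m+n lo i) (subst (_< lo + j) (+-suc lo i) (+-monoʳ-< lo 1+i<j)) (+-monoʳ-≤ lo u))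

  fromPath : ∀ {k u v} (P : Path G k u v) →
    let q = Path.vertex P ∘ clamp k in
    InducedPath _~_ S q 0 k × q 0 ≡ u × q k ≡ v ×
    (∀ {X} → Path.InteriorIn P X → Interior (Subset._∈ X) q 0 k)
  fromPath {k} P =
    inducedPath z≤n
      (λ {i} _ u → Equivalence.from (adjacent _ _)
        (fwd (≡-trans (cong suc (toℕ-clamp (<⇒≤ u))) (sym (toℕ-clamp u)))))
      (λ {i} {j} _ i<j u → ⇒S
        (λ eq → <⇒≢ (<⇒≤ i<j) (index (≤-trans (n≤1+n i) (≤-trans (<⇒≤ i<j) u)) u (injective eq)))
        λ e → nonadjacent i<j u (Equivalence.to (adjacent _ _) e)) ,
    ≡-trans (cong vertex (clamp-zero k)) start ,
    ≡-trans (cong vertex (clamp-self k)) end ,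
    λ int {i} l u → int (clamp k i)
      (λ eq → <⇒≢ l (sym (≡-trans (sym (toℕ-clamp (<⇒≤ u))) (cong toℕ eq))))
      (λ eq → <⇒≢ u (≡-trans (sym (toℕ-clamp (<⇒≤ u))) (≡-trans (cong toℕ eq) (Fin.toℕ-fromℕ k))))
    where
    open Path P
    index : ∀ {i j} → i ≤ k → j ≤ k → clamp k i ≡ clamp k j → i ≡ j
    index l u eq = ≡-trans (sym (toℕ-clamp l)) (≡-trans (cong toℕ eq) (toℕ-clamp u))
    nonadjacent : ∀ {i j} → suc i < j → j ≤ k → ¬ PathAdjacent (clamp k i) (clamp k j)
    nonadjacent {i} {j} i<j u adj
      with toℕ-clamp {k} {i} (≤-trans (n≤1+n i) (≤-trans (<⇒≤ i<j) u)) | toℕ-clamp u | adj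
    ... | eᵢ | eⱼ | fwd e = <⇒≢ i<j (≡-trans (cong suc (sym eᵢ)) (≡-trans e eⱼ))
    ... | eᵢ | eⱼ | bwd e = <⇒≢ (<-trans (n<1+n i) (<-trans i<j (n<1+n j)))
            (≡-trans (sym eᵢ) (≡-trans (sym e) (cong suc eⱼ)))

  no-odd : ∀ {k u v X} → (∀ {p lo hi} → InducedPath _~_ S p lo hi → p lo ≡ u → p hi ≡ v →
    Interior (Subset._∈ X) p lo hi → parity lo ≡ parity hi) →
    (P : Path G k u v) → Path.InteriorIn P X → ¬ Odd k
  no-odd {k} even P int odd with Q , q₀ , qₖ , inX ← fromPath P =
    odd (parity⇒even k (sym (even Q q₀ qₖ (inX int))))

-- An empty `C` would not be maximal, since `A` is nonempty and singletons are connected.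
componentNonempty : ∀ {n} (G : Graph n) {A C} → IsComponent G A C → Nonempty C
componentNonempty G {A} {C} isC with nonempty? C
... | yes ne = ne
... | no ¬ne = let (z , z∈A) = nonempty in z , maximal
        (λ x∈ → subst (Subset._∈ A) (sym (x∈⁅y⁆⇒x≡y z x∈)) z∈A)
        (λ u∈ v∈ → subst (λ w → Star _ _ w) (≡-trans (x∈⁅y⁆⇒x≡y z u∈) (sym (x∈⁅y⁆⇒x≡y z v∈))) ε)
        (λ x∈C → contradiction (_ , x∈C) ¬ne)
        (x∈⁅x⁆ z)
  where open IsComponent isC

-- Adding `y` to `C` leaves it connected, so maximality puts `y` into `C`.
componentClosed : ∀ {n} (G : Graph n) {A C} → IsComponent G A C →
  ∀ {x y} → x Subset.∈ C → y Subset.∈ A → Graph._~_ G x y → y Subset.∈ C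
componentClosed G {A} {C} isC {x} {y} x∈C y∈A x~y =
  maximal D⊆A D-connected (p⊆p∪q ⁅ y ⁆) y∈D
  where
  open Graph G
  open IsComponent isC
  D = C ∪ ⁅ y ⁆
  y∈D : y Subset.∈ D
  y∈D = q⊆p∪q C ⁅ y ⁆ (x∈⁅x⁆ y)
  D-cases : ∀ {z} → z Subset.∈ D → z Subset.∈ C ⊎ z ≡ y
  D-cases z∈D = [ inj₁ , inj₂ ∘ x∈⁅y⁆⇒x≡y y ]′ (x∈p∪q⁻ C ⁅ y ⁆ z∈D)
  D⊆A : D Subset.⊆ A
  D⊆A z∈D = [ subset , (λ { refl → y∈A }) ]′ (D-cases z∈D)
  grow : ∀ {u v} → Star (Step _~_ (Subset._∈ C)) u v → Star (Step _~_ (Subset._∈ D)) u v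
  grow = Star.map λ (u∈ , v∈ , e) → p⊆p∪q ⁅ y ⁆ u∈ , p⊆p∪q ⁅ y ⁆ v∈ , e
  x∈D = p⊆p∪q ⁅ y ⁆ x∈C
  D-connected : Connected G D
  D-connected u∈D v∈D with D-cases u∈D | D-cases v∈D
  ... | inj₁ u∈C  | inj₁ v∈C  = grow (connected u∈C v∈C)
  ... | inj₁ u∈C  | inj₂ refl = grow (connected u∈C x∈C) ◅◅ ((x∈D , y∈D , x~y) ◅ ε)
  ... | inj₂ refl | inj₁ v∈C  = (y∈D , x∈D , ~-sym x~y) ◅ grow (connected x∈C v∈C)
  ... | inj₂ refl | inj₂ refl = ε

-- Skew partitions of Berge graphs

module _ {n} (G : Graph n) (berge : Berge G) where
  open Graph G

  private
    ¬≁⇒~ : ∀ {u v} → u ≢ v → ¬ (u ≢ v × ¬ (u ~ v)) → u ~ v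
    ¬≁⇒~ {u} {v} u≢v ¬u≁v with u ~? v
    ... | yes u~v = u~v
    ... | no ¬u~v = contradiction (u≢v , ¬u~v) ¬u≁v

    module T  = Translate G (Graph._~_ (complement G)) id _,_
    module Tᶜ = Translate (complement G) _~_
      (λ u~v → (λ u≡v → ~-irrefl u≡v u~v) , λ (_ , ¬u~v) → ¬u~v u~v) ¬≁⇒~

  bergeRelation : BergeRelation (Fin n)
  bergeRelation = record
    { _~_ = _~_ ; _≁_ = Graph._~_ (complement G)
    ; trichotomy = trichotomy
    ; ~-irrefl = ~-irrefl refl ; ≁-irrefl = λ (v≢v , _) → v≢v refl
    ; exclusive = λ u~v (_ , ¬u~v) → ¬u~v u~v
    ; ~-sym = ~-sym ; ≁-sym = Graph.~-sym (complement G)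
    ; holes-even = T.holesEven (Berge.holes-even berge)
    ; antiholes-even = Tᶜ.holesEven (Berge.antiholes-even berge) }
    where
    trichotomy : ∀ u v → u ≡ v ⊎ u ~ v ⊎ (u ≢ v × ¬ (u ~ v))
    trichotomy u v with u Fin.≟ v | u ~? v
    ... | yes u≡v | _       = inj₁ u≡v
    ... | no _    | yes u~v = inj₂ (inj₁ u~v)
    ... | no u≢v  | no ¬u~v = inj₂ (inj₂ (u≢v , ¬u~v))

  admitsBalanced : BalancedSkew bergeRelation → AdmitsBalancedSkewPartition G
  admitsBalanced skew = A′ , ∁ A′ , record
      { cover = p∪∁p≡⊤ A′ ; disjoint = ∩-inverseʳ A′
      ; not-connected = separated disconnection A′⇒A A⇒A′
      ; not-anticonnected = separated antidisconnection B′⇒B B⇒B′ } , record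
      -- `Balanced` allows equal ends, whereas `_≁_` does not. A path with equal ends has length
      -- zero, which is not odd.
      { no-odd-path = λ {k} {u} {v} u∈ v∈ ¬u~v P int odd → T.no-odd
          (λ { Q refl refl inA → no-odd-path Q (B′⇒B u∈) (B′⇒B v∈)
               (ends-distinct P odd , ¬u~v) λ l h → A′⇒A (inA l h) }) P int odd
      ; no-odd-antipath = λ u∈ v∈ u~v P int odd → Tᶜ.no-odd
          (λ { Q refl refl inB → no-odd-antipath Q (A′⇒A u∈) (A′⇒A v∈) u~v λ l h → B′⇒B (inB l h) }) P int odd }
    where
    open BalancedSkew skew
    open BalancedPair balanced
    side : Fin n → Bool
    side v with cover v
    ... | inj₁ _ = true
    ... | inj₂ _ = false
    A′ = tabulate side
    A′⇒A : ∀ {v} → v Subset.∈ A′ → A v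
    A′⇒A {v} v∈A′ = side⇒A (≡-trans (sym (lookup∘tabulate side v)) ([]=⇒lookup v∈A′))
      where
      side⇒A : side v ≡ true → A v
      side⇒A e with cover v
      ... | inj₁ a = a
    A⇒A′ : ∀ {v} → A v → v Subset.∈ A′
    A⇒A′ {v} a = lookup⇒[]= v A′ (≡-trans (lookup∘tabulate side v) side-true)
      where
      side-true : side v ≡ true
      side-true with cover v
      ... | inj₁ _ = refl
      ... | inj₂ b = ⊥-elim (disjoint a b)
    B′⇒B : ∀ {v} → v Subset.∈ ∁ A′ → B v
    B′⇒B {v} v∈ = [ (λ a → contradiction (A⇒A′ a) (x∈∁p⇒x∉p v∈)) , id ]′ (cover v)
    B⇒B′ : ∀ {v} → B v → v Subset.∈ ∁ A′
    B⇒B′ b = x∉p⇒x∈∁p λ v∈A′ → disjoint (A′⇒A v∈A′) b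
    ends-distinct : ∀ {k u v} → Path G k u v → Odd k → u ≢ v
    ends-distinct {zero}  P odd _    = odd (divides 0 refl)
    ends-distinct {suc k} P odd refl
      with () ← Path.injective P {zero} {fromℕ (suc k)} (≡-trans (Path.start P) (sym (Path.end P)))
    separated : ∀ {R : Rel (Fin n) 0ℓ} {D : Fin n → Set} {X} → Disconnection R D →
      (∀ {v} → v Subset.∈ X → D v) → (∀ {v} → D v → v Subset.∈ X) →
      ¬ (∀ {u v} → u Subset.∈ X → v Subset.∈ X → Star (Step R (Subset._∈ X)) u v)
    separated {R} {X = X} disc X⇒D D⇒X connected =
      w∉S (along (connected (D⇒X u∈A) (D⇒X w∈A)) u∈S)
      where
      open Disconnection disc
      along : ∀ {x y} → Star (Step R (Subset._∈ X)) x y → S x → S y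
      along ε s = s
      along ((x∈ , y∈ , r) ◅ walk) s = along walk (closed (X⇒D x∈) (X⇒D y∈) s r)

  balancedSkewPartition : AdmitsLooseSkewPartition G → AdmitsBalancedSkewPartition G
  balancedSkewPartition (A , B , skew , loose) = admitsBalanced (fromLoose loose)
    where
    open IsSkewPartition skew
    members : Subset n → List (Fin n)
    members X = filter (λ v → v ∈ˢ? X) (allFin n)
    ∈-members : ∀ {X v} → v Subset.∈ X → v ∈ members X
    ∈-members {X} {v} v∈X = ∈-filter⁺ (λ v → v ∈ˢ? X) (∈-allFin v) v∈X
    members-∈ : ∀ {X v} → v ∈ members X → v Subset.∈ X
    members-∈ {X} v∈ = proj₂ (∈-filter⁻ (λ v → v ∈ˢ? X) {xs = allFin n} v∈)
    cover′ : ∀ v → v ∈ members A ⊎ v ∈ members B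
    cover′ v = [ inj₁ ∘ ∈-members , inj₂ ∘ ∈-members ]′
      (x∈p∪q⁻ A B (subst (v Subset.∈_) (sym cover) ∈⊤))
    disjoint′ : ∀ {v} → v Subset.∈ A → v Subset.∈ B → ⊥
    disjoint′ {v} v∈A v∈B = ∉⊥ (subst (v Subset.∈_) disjoint (x∈p∩q⁺ (v∈A , v∈B)))
    spanning : ∀ (𝔾 : BergeRelation (Fin n)) {X} →
      ¬ (∀ {u v} → u Subset.∈ X → v Subset.∈ X → Star (Step (BergeRelation._~_ 𝔾) (Subset._∈ X)) u v) →
      ∀ {K} → ConnectedList (BergeRelation._~_ 𝔾) K → (∀ {z} → z ∈ K → z ∈ members X) →
      ¬ (∀ {z} → z ∈ members X → z ∈ K)
    spanning 𝔾 ¬connected conn K⊆X X⊆K = ¬connected λ u∈X v∈X →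
      Star.map (λ (x∈K , y∈K , r) → members-∈ (K⊆X x∈K) , members-∈ (K⊆X y∈K) , r)
        (Paths.walkInList 𝔾 conn (X⊆K (∈-members u∈X)) (X⊆K (∈-members v∈X)))
    fromLoose : Loose G A B → BalancedSkew bergeRelation
    fromLoose (inj₂ (v , v∈A , C , isC , v~C)) = balance bergeRelation _
      (looseSkew bergeRelation {C = Subset._∈ C} cover′
        (λ a b → disjoint′ (members-∈ a) (members-∈ b))
        (spanning bergeRelation not-connected) (spanning (dual bergeRelation) not-anticonnected)
        (∈-members v∈A) (∈-members (IsComponent.subset isC c∈C)) c∈C
        (λ x∈C y∈B x≁y → componentClosed (complement G) isC x∈C (members-∈ y∈B) x≁y) v~C)
      ≤-refl
      where c∈C = proj₂ (componentNonempty (complement G) isC)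
    -- In the complement `A` and `B` exchange their roles, and `v` is complete to `C`, which is an
    -- anticomponent there.
    fromLoose (inj₁ (v , v∈B , C , isC , v≁C)) = dualSkew (balance (dual bergeRelation) _
      (looseSkew (dual bergeRelation) {C = Subset._∈ C} (λ v → [ inj₂ , inj₁ ]′ (cover′ v))
        (λ b a → disjoint′ (members-∈ a) (members-∈ b))
        (spanning (dual bergeRelation) not-anticonnected) (spanning bergeRelation not-connected)
        (∈-members v∈B) (∈-members (IsComponent.subset isC c∈C)) c∈C
        (λ x∈C y∈A x~y → componentClosed G isC x∈C (members-∈ y∈A) x~y)
        (λ x∈C → (λ { refl → disjoint′ (IsComponent.subset isC x∈C) v∈B }) , v≁C x∈C))
      ≤-refl)
      where c∈C = proj₂ (componentNonempty G isC)

theorem4p2 : ∀ (n : ℕ) (G : Graph n) → Berge G →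
    AdmitsLooseSkewPartition G → AdmitsBalancedSkewPartition G
theorem4p2 n G = balancedSkewPartition G
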